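{- Let $n, k$ be two positive integers. For any real number $\varepsilon$ with $0<\varepsilon<\frac{1}{3}$, there exists an integer $N=N(\varepsilon,n,k)$ such that for every connected graph $G$ with $|V(G)|\equiv n \pmod 2$, if $b(G)>\frac{4}{3}+\varepsilon$ and the order of $G$ is at least $N$, then $G$ is $(n,k)$-extendable.
   Context: All graphs are finite, simple and connected. The order of $G$ is $|V(G)|$. For $S\subseteq V(G)$, $N_G(S)$ denotes the set of all vertices of $G$ that are adjacent to at least one vertex of $S$ (it may contain vertices of $S$). The binding number is $b(G)=\min \frac{|N_G(S)|}{|S|}$, the minimum taken over all $S\subseteq V(G)$ with $S\neq\emptyset$ and $N_G(S)\neq V(G)$. A matching is a set of pairwise independent (vertex-disjoint) edges; a $k$-matching is a matching with exactly $k$ edges; a perfect matching is a matching covering all vertices. Let $G$ be a graph and $n,k$ nonnegative integers with $|V(G)|\geq n+2k+2$ and $|V(G)|-n\equiv 0\pmod 2$. $G$ is called $(n,k)$-extendable if, after deleting any $n$ vertices from $G$, the remaining subgraph contains a $k$-matching and, moreover, each $k$-matching in the remaining subgraph is contained in a perfect matching of the remaining subgraph. -}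

module Defs where

open import Data.Empty using (⊥)
open import Data.Fin using (Fin) renaming (_<_ to _<ᶠ_)
open import Data.Fin.Properties using (any?)
open import Data.Fin.Subset using (Subset; _∈_; Nonempty; ∣_∣; ∁; ⊤; inside; outside)
open import Data.Fin.Subset.Properties using (_∈?_)
open import Data.Integer using (+_)
open import Data.List using (List; length)
open import Data.List.Relation.Binary.Subset.Propositional using (_⊆_)
open import Data.List.Relation.Unary.All using (All)
open import Data.List.Relation.Unary.AllPairs using (AllPairs)
open import Data.List.Relation.Unary.Any using (Any)
open import Data.Nat as ℕ using (ℕ; NonZero; _%_)
open import Data.Product using (_×_; _,_; ∃; ∃-syntax; Σ-syntax)
open import Data.Rational as ℚ using (ℚ; _/_; 0ℚ; 1ℚ; _<_; _+_; _-_; -_)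
import Data.Rational.Properties as ℚₚ
open import Data.Sum using (_⊎_; inj₁; inj₂)
open import Data.Vec using (_∷_; tabulate; here; there)
open import Relation.Binary.Construct.Closure.ReflexiveTransitive using (Star)
open import Relation.Binary.Definitions using (tri<; tri≈; tri>)
open import Relation.Binary.PropositionalEquality
  using (_≡_; _≢_; refl; sym; trans; cong; subst)
open import Relation.Nullary using (¬_; Dec; does)
open import Relation.Nullary.Decidable using (_×-dec_)

-- Real numbers, as two-sided located Dedekind cuts of ℚ.

record ℝ : Set₁ where
  field
    lower upper     : ℚ → Set
    lower-inhabited : ∃ lower
    upper-inhabited : ∃ upper
    lower-closed    : ∀ {p q} → p < q → lower q → lower p
    lower-open      : ∀ {p} → lower p → ∃[ q ] (p < q × lower q)
    upper-closed    : ∀ {p q} → p < q → upper p → upper q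
    upper-open      : ∀ {q} → upper q → ∃[ p ] (p < q × upper p)
    disjoint        : ∀ {q} → lower q → upper q → ⊥
    located         : ∀ {p q} → p < q → lower p ⊎ upper q

open ℝ

infix 4 _<ᵣ_

_<ᵣ_ : ℝ → ℝ → Set
x <ᵣ y = ∃[ q ] (upper x q × lower y q)

private
  -1<0 : - 1ℚ < 0ℚ
  -1<0 = ℚₚ.negative⁻¹ (- 1ℚ)

  0<1 : 0ℚ < 1ℚ
  0<1 = ℚₚ.positive⁻¹ 1ℚ

  +-monoˡ : ∀ {p q} c → p < q → p + c < q + c
  +-monoˡ c = ℚₚ.+-monoˡ-< c

  [p+c]-c : ∀ p c → (p + c) - c ≡ p
  [p+c]-c p c = trans (ℚₚ.+-assoc p c (- c))
    (trans (cong (λ z → p + z) (ℚₚ.+-inverseʳ c)) (ℚₚ.+-identityʳ p))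

  [p-c]+c : ∀ p c → (p - c) + c ≡ p
  [p-c]+c p c = trans (ℚₚ.+-assoc p (- c) c)
    (trans (cong (λ z → p + z) (ℚₚ.+-inverseˡ c)) (ℚₚ.+-identityʳ p))

fromℚ : ℚ → ℝ
fromℚ r .lower p = p < r
fromℚ r .upper q = r < q
fromℚ r .lower-inhabited =
  r - 1ℚ , subst (r - 1ℚ <_) (ℚₚ.+-identityʳ r) (ℚₚ.+-monoʳ-< r -1<0)
fromℚ r .upper-inhabited =
  r + 1ℚ , subst (_< r + 1ℚ) (ℚₚ.+-identityʳ r) (ℚₚ.+-monoʳ-< r 0<1)
fromℚ r .lower-closed = ℚₚ.<-trans
fromℚ r .lower-open p<r = ℚₚ.<-dense p<r
fromℚ r .upper-closed p<q r<p = ℚₚ.<-trans r<p p<q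
fromℚ r .upper-open r<q with m , r<m , m<q ← ℚₚ.<-dense r<q = m , m<q , r<m
fromℚ r .disjoint = ℚₚ.<-asym
fromℚ r .located {p} {q} p<q with ℚₚ.<-cmp p r
... | tri< p<r _ _    = inj₁ p<r
... | tri≈ _ refl _   = inj₂ p<q
... | tri> _ _ r<p    = inj₂ (ℚₚ.<-trans r<p p<q)

-- The sum c + x of a rational c and a real x.

infixr 6 _ℚ+ℝ_

_ℚ+ℝ_ : ℚ → ℝ → ℝ
(c ℚ+ℝ x) .lower p = lower x (p - c)
(c ℚ+ℝ x) .upper q = upper x (q - c)
(c ℚ+ℝ x) .lower-inhabited with p , l ← lower-inhabited x =
  p + c , subst (lower x) (sym ([p+c]-c p c)) l
(c ℚ+ℝ x) .upper-inhabited with q , u ← upper-inhabited x =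
  q + c , subst (upper x) (sym ([p+c]-c q c)) u
(c ℚ+ℝ x) .lower-closed p<q = lower-closed x (+-monoˡ (- c) p<q)
(c ℚ+ℝ x) .lower-open {p} l with q , p-c<q , l′ ← lower-open x l =
  q + c , subst (_< q + c) ([p-c]+c p c) (+-monoˡ c p-c<q)
        , subst (lower x) (sym ([p+c]-c q c)) l′
(c ℚ+ℝ x) .upper-closed p<q = upper-closed x (+-monoˡ (- c) p<q)
(c ℚ+ℝ x) .upper-open {q} u with p , p<q-c , u′ ← upper-open x u =
  p + c , subst (p + c <_) ([p-c]+c q c) (+-monoˡ c p<q-c)
        , subst (upper x) (sym ([p+c]-c p c)) u′
(c ℚ+ℝ x) .disjoint = disjoint x
(c ℚ+ℝ x) .located p<q = located x (+-monoˡ (- c) p<q)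

-- Finite simple graphs. Adjacency is decidable so that neighbourhoods are
-- finite subsets with a computable cardinality.

record Graph : Set₁ where
  field
    order  : ℕ
    Adj    : Fin order → Fin order → Set
    adj?   : ∀ u v → Dec (Adj u v)
    symm   : ∀ {u v} → Adj u v → Adj v u
    irrefl : ∀ {v} → ¬ Adj v v

  Vertex : Set
  Vertex = Fin order

open Graph public using (order)

module _ (G : Graph) where
  open Graph G using (Vertex; Adj; adj?)

  Connected : Set
  Connected = ∀ u v → Star Adj u v

  neighbours : Subset (order G) → Subset (order G)
  neighbours S = tabulate λ v → does (any? λ u → (u ∈? S) ×-dec adj? u v)

private
  nonempty⇒nonZero : ∀ {n} (S : Subset n) → Nonempty S → NonZero ∣ S ∣
  nonempty⇒nonZero (inside  ∷ S) _                   = _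
  nonempty⇒nonZero (outside ∷ S) (_ , there x∈S) = nonempty⇒nonZero S (_ , x∈S)

module _ (G : Graph) where
  open Graph G using (Vertex; Adj)

  bindingRatio : (S : Subset (order G)) → Nonempty S → ℚ
  bindingRatio S S≠∅ = _/_ (+ ∣ neighbours G S ∣) ∣ S ∣ {{nonempty⇒nonZero S S≠∅}}

  -- b is the minimum defining the binding number of G: it is attained by an
  -- admissible S and is a lower bound over all admissible S.
  IsBindingNumber : ℚ → Set
  IsBindingNumber b =
    (∃[ S ] Σ[ S≠∅ ∈ Nonempty S ] (neighbours G S ≢ ⊤ × b ≡ bindingRatio S S≠∅))
    × (∀ S (S≠∅ : Nonempty S) → neighbours G S ≢ ⊤ → b ℚ.≤ bindingRatio S S≠∅)

  -- The edges of the subgraph induced on W. An undirected edge {u , v} is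
  -- represented only by the pair with u < v, so equality of edges is equality
  -- of pairs.
  IsEdge : Subset (order G) → Vertex × Vertex → Set
  IsEdge W (u , v) = u <ᶠ v × Adj u v × u ∈ W × v ∈ W

  _∈ₑ_ : Vertex → Vertex × Vertex → Set
  w ∈ₑ (u , v) = w ≡ u ⊎ w ≡ v

  Disjoint : Vertex × Vertex → Vertex × Vertex → Set
  Disjoint e f = ∀ w → w ∈ₑ e → w ∈ₑ f → ⊥

  -- Matchings of the subgraph induced on W. Edges at distinct positions are
  -- disjoint, so the list has no repetitions and its length is the number of
  -- edges.
  IsMatching : Subset (order G) → List (Vertex × Vertex) → Set
  IsMatching W M = All (IsEdge W) M × AllPairs Disjoint M

  IsPerfectMatching : Subset (order G) → List (Vertex × Vertex) → Set
  IsPerfectMatching W M = IsMatching W M × (∀ w → w ∈ W → Any (w ∈ₑ_) M)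

  record Extendable (n k : ℕ) : Set where
    field
      large  : n ℕ.+ 2 ℕ.* k ℕ.+ 2 ℕ.≤ order G
      parity : order G % 2 ≡ n % 2
      exists : ∀ (D : Subset (order G)) → ∣ D ∣ ≡ n →
               ∃[ M ] (IsMatching (∁ D) M × length M ≡ k)
      extend : ∀ (D : Subset (order G)) → ∣ D ∣ ≡ n →
               ∀ M → IsMatching (∁ D) M → length M ≡ k →
               ∃[ M′ ] (IsPerfectMatching (∁ D) M′ × M ⊆ M′)

{-# OPTIONS --safe #-}

-- Lovász's proof of Tutte's theorem is run on the graph left after deleting the
-- n + 2k vertices, with the binding condition in place of Tutte's. For an m
-- with 1/(3m) ≤ ε it gives (4m+1)|X| + 3m|Y| ≤ 3m|V| for all nonempty X and Y
-- without edges between them, and in this form it survives the addition of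
-- edges. If ab and bc are edges but ac and bd are not, perfect matchings of G +
-- ac and G + bd, which exist by induction on the number of non-edges, combine
-- to one of G. Otherwise the graph outside the set U of universal vertices is a
-- disjoint union of cliques, and a matching that cannot be augmented leaves at
-- least |U| + 2 odd cliques. Let x be the number of vertices outside U. If some
-- odd cliques are single vertices, let Y consist of these and X of all vertices
-- outside U; if none is, let Y run over the odd cliques and X over their
-- complements outside U. As a clique with more than one vertex has at least
-- three when it is odd, either choice bounds x, and with it the order of the
-- graph, in terms of m, n and k.

module Submission where

open import Defs
open import Data.Bool using (if_then_else_; true; false)
open import Data.Empty using (⊥-elim)
open import Data.Fin as Fin using (Fin; zero; suc)
open import Data.Fin.Permutation using (permutation)
open import Data.Fin.Permutation.Components using (transpose)
open import Data.Fin.Properties as Finₚ using (_≟_; any?; all?)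
open import Data.Fin.Subset using (Subset; _∈_; ∣_∣; ∁; ⊤)
open import Data.Fin.Subset.Properties using (_∈?_; ∈⊤; x∈∁p⇒x∉p; x∉p⇒x∈∁p)
open import Data.Integer as ℤ using (+_; +[1+_])
import Data.Integer.Properties as ℤₚ
open import Data.List using (List; []; _∷_; length; map; filter; take; allFin; _++_)
open import Data.List.Membership.Propositional using (lose)
open import Data.List.Membership.Propositional.Properties using (∈-map⁺; ∈-filter⁺; ∈-allFin)
open import Data.List.Properties using (length-take)
open import Data.List.Relation.Binary.Subset.Propositional using (_⊆_)
open import Data.List.Relation.Binary.Subset.Propositional.Properties using (xs⊆xs++ys)
open import Data.List.Relation.Unary.All as All using (All)
import Data.List.Relation.Unary.All.Properties as Allₚ
open import Data.List.Relation.Unary.AllPairs as AllPairs using (AllPairs)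
import Data.List.Relation.Unary.AllPairs.Properties as AllPairsₚ
open import Data.List.Relation.Unary.Any as Any using (Any; here; there)
import Data.List.Relation.Unary.Any.Properties as Anyₚ
import Data.List.Relation.Unary.Unique.Propositional.Properties as Uniqueₚ
open import Data.Nat using (ℕ; zero; suc; _+_; _*_; _%_; _<_; _≤_; z≤n; s≤s; NonZero; >-nonZero)
open import Data.Nat.Coprimality using (Coprime)
open import Data.Nat.Divisibility using (_∣_; divides; ∣m+n∣m⇒∣n; ∣⇒≤)
import Data.Nat.DivMod as DivMod
open import Data.Nat.Induction using (Acc; acc; <-wellFounded)
open import Data.Nat.Properties hiding (_≟_)
open import Data.Nat.Tactic.RingSolver using (solve)
open import Data.Product using (_×_; _,_; ∃; ∃-syntax; proj₁; proj₂)
open import Data.Rational as ℚ using (ℚ; mkℚ; _/_; 0ℚ)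
import Data.Rational.Properties as ℚₚ
open import Data.Rational.Unnormalised as ℚᵘ using (mkℚᵘ)
import Data.Rational.Unnormalised.Properties as ℚᵘₚ
open import Data.Sum using (_⊎_; inj₁; inj₂; [_,_]′)
open import Data.Vec as Vec using (tabulate)
open import Data.Vec.Properties using (lookup∘tabulate; lookup⇒[]=; []=⇒lookup)
open import Function using (_∘_; id)
open import Level using (0ℓ)
open import Relation.Binary using (Rel)
open import Relation.Binary.Definitions using (tri<; tri≈; tri>)
open import Relation.Binary.PropositionalEquality
open import Relation.Nullary using (¬_; Dec; yes; no; does; contradiction)
open import Relation.Nullary.Decidable using (_×-dec_; _⊎-dec_; _→-dec_; ¬?; dec-true; dec-false)
open import Relation.Unary using (Pred; Decidable)
open import Algebra.Properties.Semiring.Sum +-*-semiring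

-- Counting

sum-mono-≤ : ∀ {n} {f g : Fin n → ℕ} → (∀ v → f v ≤ g v) → sum f ≤ sum g
sum-mono-≤ {zero}  f≤g = z≤n
sum-mono-≤ {suc n} f≤g = +-mono-≤ (f≤g zero) (sum-mono-≤ (f≤g ∘ suc))

sum-mono-< : ∀ {n} {f g : Fin n → ℕ} → (∀ v → f v ≤ g v) → ∀ v → f v < g v → sum f < sum g
sum-mono-< f≤g zero    fv<gv = +-mono-<-≤ fv<gv (sum-mono-≤ (f≤g ∘ suc))
sum-mono-< f≤g (suc v) fv<gv = +-mono-≤-< (f≤g zero) (sum-mono-< (f≤g ∘ suc) v fv<gv)

indicator : ∀ {A : Set} → Dec A → ℕ
indicator A? = if does A? then 1 else 0

indicator-yes : ∀ {A : Set} (A? : Dec A) → A → indicator A? ≡ 1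
indicator-yes (yes _) _ = refl
indicator-yes (no ¬a) a = contradiction a ¬a

indicator-no : ∀ {A : Set} (A? : Dec A) → ¬ A → indicator A? ≡ 0
indicator-no (yes a) ¬a = contradiction a ¬a
indicator-no (no _)  _  = refl

indicator-mono : ∀ {A B : Set} (A? : Dec A) (B? : Dec B) → (A → B) → indicator A? ≤ indicator B?
indicator-mono (yes a) B? A→B = ≤-reflexive (sym (indicator-yes B? (A→B a)))
indicator-mono (no _)  B? A→B = z≤n

count : ∀ {n} {P : Pred (Fin n) 0ℓ} → Decidable P → ℕ
count P? = sum λ v → indicator (P? v)

module _ {n : ℕ} {P Q : Pred (Fin n) 0ℓ} (P? : Decidable P) (Q? : Decidable Q) where

  count-mono-≤ : (∀ v → P v → Q v) → count P? ≤ count Q?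
  count-mono-≤ P⊆Q = sum-mono-≤ λ v → indicator-mono (P? v) (Q? v) (P⊆Q v)

  count-mono-< : (∀ v → P v → Q v) → ∀ v → ¬ P v → Q v → count P? < count Q?
  count-mono-< P⊆Q v ¬Pv Qv =
    sum-mono-< (λ w → indicator-mono (P? w) (Q? w) (P⊆Q w)) v
      (≤-reflexive (trans (cong suc (indicator-no (P? v) ¬Pv)) (sym (indicator-yes (Q? v) Qv))))

count-cong : ∀ {n} {P Q : Pred (Fin n) 0ℓ} (P? : Decidable P) (Q? : Decidable Q) →
             (∀ v → P v → Q v) → (∀ v → Q v → P v) → count P? ≡ count Q?
count-cong P? Q? P⊆Q Q⊆P = ≤-antisym (count-mono-≤ P? Q? P⊆Q) (count-mono-≤ Q? P? Q⊆P)

count-partition : ∀ {n} {P Q R : Pred (Fin n) 0ℓ}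
  (P? : Decidable P) (Q? : Decidable Q) (R? : Decidable R) →
  (∀ v → R v → P v ⊎ Q v) → (∀ v → P v → R v) → (∀ v → Q v → R v) →
  (∀ v → P v → ¬ Q v) → count R? ≡ count P? + count Q?
count-partition P? Q? R? R⊆P∪Q P⊆R Q⊆R disjoint =
  trans (sum-cong-≗ pointwise) (∑-distrib-+ (indicator ∘ P?) (indicator ∘ Q?))
  where
  pointwise : ∀ v → indicator (R? v) ≡ indicator (P? v) + indicator (Q? v)
  pointwise v with P? v | Q? v
  ... | yes p | yes q = contradiction q (disjoint v p)
  ... | yes p | no  _ = indicator-yes (R? v) (P⊆R v p)
  ... | no  _ | yes q = indicator-yes (R? v) (Q⊆R v q)
  ... | no ¬p | no ¬q = indicator-no (R? v) λ r → [ ¬p , ¬q ]′ (R⊆P∪Q v r)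

count-involution : ∀ {n} {P : Pred (Fin n) 0ℓ} (P? : Decidable P) (h : Fin n → Fin n) →
                   (∀ v → h (h v) ≡ v) → count (P? ∘ h) ≡ count P?
count-involution P? h inv = sym (sum-permute (indicator ∘ P?) (permutation h h inv inv))

count-none : ∀ {n} {P : Pred (Fin n) 0ℓ} (P? : Decidable P) → (∀ v → ¬ P v) → count P? ≡ 0
count-none {n} P? ¬P =
  trans (sum-cong-≗ λ v → indicator-no (P? v) (¬P v)) (sum-replicate-zero n)

count-all : ∀ {n} {P : Pred (Fin n) 0ℓ} (P? : Decidable P) → (∀ v → P v) → count P? ≡ n
count-all {zero}  P? all = refl
count-all {suc n} P? all = cong₂ _+_ (indicator-yes (P? zero) (all zero)) (count-all (P? ∘ suc) (all ∘ suc))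

count-complement : ∀ {n} {P : Pred (Fin n) 0ℓ} (P? : Decidable P) → count P? + count (¬? ∘ P?) ≡ n
count-complement {n} {P} P? = trans (sym (count-partition P? (¬? ∘ P?) (λ v → P? v ⊎-dec ¬? (P? v))
  (λ _ → id) (λ _ → inj₁) (λ _ → inj₂) λ _ p ¬p → ¬p p)) (count-all (λ v → P? v ⊎-dec ¬? (P? v)) decide)
  where
  decide : ∀ v → P v ⊎ ¬ P v
  decide v with P? v
  ... | yes p = inj₁ p
  ... | no ¬p = inj₂ ¬p

count-singleton : ∀ {n} (v : Fin n) → count (_≟ v) ≡ 1
count-singleton {suc n} zero    = cong suc (count-none {n} (λ w → suc w ≟ Fin.zero {n}) λ _ ())
count-singleton {suc n} (suc v) =
  trans (count-cong {n} (λ w → suc w ≟ suc v) (_≟ v) (λ { _ refl → refl }) λ { _ refl → refl })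
        (count-singleton v)

count-pair : ∀ {n} {u v : Fin n} → u ≢ v → count (λ w → w ≟ u ⊎-dec w ≟ v) ≡ 2
count-pair {u = u} {v} u≢v =
  trans (count-partition (_≟ u) (_≟ v) (λ w → w ≟ u ⊎-dec w ≟ v)
           (λ _ → id) (λ _ → inj₁) (λ _ → inj₂) λ { _ refl refl → u≢v refl })
        (cong₂ _+_ (count-singleton u) (count-singleton v))

module _ {n : ℕ} {P : Pred (Fin n) 0ℓ} (P? : Decidable P) where

  1≤count : ∀ {v} → P v → 1 ≤ count P?
  1≤count {v} p = ≤-trans (≤-reflexive (sym (count-singleton v)))
    (count-mono-≤ (_≟ v) P? λ { _ refl → p })

  2≤count : ∀ {u v} → u ≢ v → P u → P v → 2 ≤ count P?
  2≤count {u} {v} u≢v p q = ≤-trans (≤-reflexive (sym (count-pair u≢v)))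
    (count-mono-≤ (λ w → w ≟ u ⊎-dec w ≟ v) P? λ { _ (inj₁ refl) → p ; _ (inj₂ refl) → q })

  count-unique : (∀ u v → P u → P v → u ≡ v) → count P? ≤ 1
  count-unique unique with any? P?
  ... | yes (v , p) = ≤-trans (count-mono-≤ P? (_≟ v) λ u q → unique u v q p)
                              (≤-reflexive (count-singleton v))
  ... | no ¬p       = ≤-trans (≤-reflexive (count-none P? λ v p → ¬p (v , p))) z≤n

-- Double counting of the pairs (v , w) with Q v and C v w.
count-family : ∀ {n} {Q Z : Pred (Fin n) 0ℓ} {C : Fin n → Pred (Fin n) 0ℓ}
  (Q? : Decidable Q) (Z? : Decidable Z) (C? : ∀ v → Decidable (C v)) →
  (∀ v w → Q v → C v w → Z w) →
  (∀ u v w → Q u → Q v → C u w → C v w → u ≡ v) →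
  ∀ a b s → (∀ v → Q v → a ≤ b + s * count (C? v)) →
  count Q? * a ≤ count Q? * b + s * count Z?
count-family {n} {Q} {Z} {C} Q? Z? C? C⊆Z disjoint a b s bound = begin
  count Q? * a
    ≡⟨ *-distribʳ-sum a (indicator ∘ Q?) ⟩
  ∑[ v < n ] (indicator (Q? v) * a)
    ≤⟨ sum-mono-≤ pointwise ⟩
  ∑[ v < n ] (indicator (Q? v) * b + s * count (QC? v))
    ≡⟨ ∑-distrib-+ (λ v → indicator (Q? v) * b) (λ v → s * count (QC? v)) ⟩
  ∑[ v < n ] (indicator (Q? v) * b) + ∑[ v < n ] (s * count (QC? v))
    ≡⟨ cong₂ _+_ (*-distribʳ-sum b (indicator ∘ Q?)) (*-distribˡ-sum s (λ v → count (QC? v))) ⟨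
  count Q? * b + s * (∑[ v < n ] count (QC? v))
    ≡⟨ cong (λ z → count Q? * b + s * z) (∑-comm (λ v w → indicator (QC? v w))) ⟩
  count Q? * b + s * (∑[ w < n ] count (λ v → QC? v w))
    ≤⟨ +-monoʳ-≤ (count Q? * b) (*-monoʳ-≤ s (sum-mono-≤ atMostOne)) ⟩
  count Q? * b + s * count Z? ∎
  where
  open ≤-Reasoning
  QC? : ∀ v → Decidable (λ w → Q v × C v w)
  QC? v w = Q? v ×-dec C? v w

  pointwise : ∀ v → indicator (Q? v) * a ≤ indicator (Q? v) * b + s * count (QC? v)
  pointwise v with Q? v in eq
  ... | no _  = z≤n
  ... | yes q = begin
    a + 0                     ≡⟨ +-identityʳ a ⟩
    a                         ≤⟨ bound v q ⟩
    b + s * count (C? v)      ≤⟨ +-mono-≤ (m≤m+n b 0) (*-monoʳ-≤ s (count-mono-≤ (C? v) (λ w → yes q ×-dec C? v w) λ w c → q , c)) ⟩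
    b + 0 + s * count (λ w → yes q ×-dec C? v w) ∎

  atMostOne : ∀ w → count (λ v → QC? v w) ≤ indicator (Z? w)
  atMostOne w with Z? w
  ... | yes _ = count-unique (λ v → QC? v w) λ { u v (qu , cu) (qv , cv) → disjoint u v w qu qv cu cv }
  ... | no ¬z = ≤-reflexive (count-none (λ v → QC? v w) λ { v (q , c) → ¬z (C⊆Z v w q c) })

-- Matchings as involutions

transpose-matchˡ : ∀ {n} (i j : Fin n) → transpose i j i ≡ j
transpose-matchˡ i j rewrite dec-true (i ≟ i) refl = refl

transpose-matchʳ : ∀ {n} (i j : Fin n) → transpose i j j ≡ i
transpose-matchʳ i j with j ≟ i
... | yes j≡i = j≡i
... | no  _ rewrite dec-true (j ≟ j) refl = refl

transpose-mismatch : ∀ {n} {i j k : Fin n} → k ≢ i → k ≢ j → transpose i j k ≡ k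
transpose-mismatch {i = i} {j} {k} k≢i k≢j
  rewrite dec-false (k ≟ i) k≢i | dec-false (k ≟ j) k≢j = refl

transpose-involutive : ∀ {n} (i j k : Fin n) → transpose i j (transpose i j k) ≡ k
transpose-involutive i j k = go (k ≟ i) (k ≟ j)
  where
  go : Dec (k ≡ i) → Dec (k ≡ j) → transpose i j (transpose i j k) ≡ k
  go (yes refl) _          = trans (cong (transpose i j) (transpose-matchˡ i j)) (transpose-matchʳ i j)
  go (no _)     (yes refl) = trans (cong (transpose i j) (transpose-matchʳ i j)) (transpose-matchˡ i j)
  go (no k≢i)   (no k≢j)   =
    trans (cong (transpose i j) (transpose-mismatch k≢i k≢j)) (transpose-mismatch k≢i k≢j)

module _ {n : ℕ} where

  private
    V = Fin n

  AddEdge : Rel V 0ℓ → V → V → Rel V 0ℓ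
  AddEdge E a c u v = E u v ⊎ ((u ≡ a × v ≡ c) ⊎ (u ≡ c × v ≡ a))

  -- The vertices left uncovered are the fixed points of h.
  record Matching (E : Rel V 0ℓ) (h : V → V) : Set where
    field
      involutive : ∀ v → h (h v) ≡ v
      edge       : ∀ v → h v ≢ v → E v (h v)

    injective : ∀ {u v} → h u ≡ h v → u ≡ v
    injective {u} {v} eq = trans (sym (involutive u)) (trans (cong h eq) (involutive v))

    flip : ∀ {u v} → h u ≡ v → h v ≡ u
    flip {u} refl = involutive u

    moved : ∀ {v} → h v ≢ v → h (h v) ≢ h v
    moved hv≢v eq = hv≢v (injective eq)

  open Matching public

  Matching-mono : ∀ {E F : Rel V 0ℓ} {h} → (∀ u v → E u v → F u v) → Matching E h → Matching F h
  Matching-mono E⊆F M .involutive  = M .involutive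
  Matching-mono E⊆F M .edge v hv≢v = E⊆F v _ (M .edge v hv≢v)

  -- Joins and rotations give a matching of the graph with one extra pair; once that pair is known
  -- to be an edge, nothing was added.
  absorb : ∀ {E : Rel V 0ℓ} {a c h} → (∀ {u v} → E u v → E v u) → E a c →
           Matching (AddEdge E a c) h → Matching E h
  absorb {E} {a} {c} E-sym Eac = Matching-mono include
    where
    include : ∀ u v → AddEdge E a c u v → E u v
    include u v (inj₁ Euv)                  = Euv
    include u v (inj₂ (inj₁ (refl , refl))) = Eac
    include u v (inj₂ (inj₂ (refl , refl))) = E-sym Eac

  oldEdge : ∀ (E : Rel V 0ℓ) {a c u v} → u ≢ a → u ≢ c → AddEdge E a c u v → E u v
  oldEdge E u≢a u≢c (inj₁ Euv)              = Euv
  oldEdge E u≢a u≢c (inj₂ (inj₁ (u≡a , _))) = contradiction u≡a u≢a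
  oldEdge E u≢a u≢c (inj₂ (inj₂ (u≡c , _))) = contradiction u≡c u≢c

  -- Meant for fixed points `u` and `v` of a matching: no other vertex is sent to them, so composing
  -- with the transposition adds their pair and changes nothing else.
  join : V → V → (V → V) → V → V
  join u v h w = transpose u v (h w)

  module _ {E : Rel V 0ℓ} {h : V → V} (M : Matching E h) {u v : V}
           (hu≡u : h u ≡ u) (hv≡v : h v ≡ v) where

    join-left : join u v h u ≡ v
    join-left = trans (cong (transpose u v) hu≡u) (transpose-matchˡ u v)

    join-right : join u v h v ≡ u
    join-right = trans (cong (transpose u v) hv≡v) (transpose-matchʳ u v)

    join-other : ∀ {w} → w ≢ u → w ≢ v → join u v h w ≡ h w
    join-other w≢u w≢v = transpose-mismatch
      (λ hw≡u → w≢u (injective M (trans hw≡u (sym hu≡u))))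
      (λ hw≡v → w≢v (injective M (trans hw≡v (sym hv≡v))))

    join-matching : Matching (AddEdge E u v) (join u v h)
    join-matching .involutive w with w ≟ u | w ≟ v
    ... | yes refl | _        = trans (cong (join u v h) join-left) join-right
    ... | no _     | yes refl = trans (cong (join u v h) join-right) join-left
    ... | no w≢u   | no w≢v   = trans (cong (transpose u v ∘ h) (join-other w≢u w≢v))
      (trans (cong (transpose u v) (M .involutive w)) (transpose-mismatch w≢u w≢v))
    join-matching .edge w moves with w ≟ u | w ≟ v
    ... | yes refl | _        = inj₂ (inj₁ (refl , join-left))
    ... | no _     | yes refl = inj₂ (inj₂ (refl , join-right))
    ... | no w≢u   | no w≢v   rewrite join-other w≢u w≢v = inj₁ (M .edge w moves)

    join-fixed : u ≢ v → ∀ w → join u v h w ≡ w → h w ≡ w × w ≢ u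
    join-fixed u≢v w fixed with w ≟ u | w ≟ v
    ... | yes refl | _        = contradiction (trans (sym fixed) join-left) u≢v
    ... | no w≢u   | yes refl = contradiction (trans (sym join-right) fixed) u≢v
    ... | no w≢u   | no w≢v   = trans (sym (join-other w≢u w≢v)) fixed , w≢u

  -- Conjugation by the transposition of b and y replaces the matched pairs b x
  -- and y (h y) by x y and b (h y).
  rotate : V → V → (V → V) → V → V
  rotate b y h w = transpose b y (h (transpose b y w))

  module Rotation {E : Rel V 0ℓ} {h : V → V} {b x y : V}
    (E-sym : ∀ {u v} → E u v → E v u)
    (M : Matching (AddEdge E b x) h) (hb≡x : h b ≡ x) (x≢b : x ≢ b)
    (y≢b : y ≢ b) (y≢x : y ≢ x) (hy≢y : h y ≢ y) where

    private
      z  = h y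
      h′ = rotate b y h

      hx≡b : h x ≡ b
      hx≡b = flip M hb≡x

      z≢b : z ≢ b
      z≢b hy≡b = y≢x (trans (sym (flip M hy≡b)) hb≡x)

    at-b : h′ b ≡ z
    at-b = trans (cong (transpose b y ∘ h) (transpose-matchˡ b y)) (transpose-mismatch z≢b hy≢y)

    at-x : h′ x ≡ y
    at-x = trans (cong (transpose b y ∘ h) (transpose-mismatch x≢b (y≢x ∘ sym)))
                 (trans (cong (transpose b y) hx≡b) (transpose-matchˡ b y))

    at-y : h′ y ≡ x
    at-y = trans (cong (transpose b y ∘ h) (transpose-matchʳ b y))
                 (trans (cong (transpose b y) hb≡x) (transpose-mismatch x≢b (y≢x ∘ sym)))

    at-z : h′ z ≡ b
    at-z = trans (cong (transpose b y ∘ h) (transpose-mismatch z≢b hy≢y))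
                 (trans (cong (transpose b y) (M .involutive y)) (transpose-matchʳ b y))

    elsewhere : ∀ {w} → w ≢ b → w ≢ x → w ≢ y → w ≢ z → h′ w ≡ h w
    elsewhere w≢b w≢x w≢y w≢z =
      trans (cong (transpose b y ∘ h) (transpose-mismatch w≢b w≢y))
            (transpose-mismatch (λ hw≡b → w≢x (trans (sym (flip M hw≡b)) hb≡x))
                                (λ hw≡y → w≢z (sym (flip M hw≡y))))

    data Position (w : V) : Set where
      is-b  : w ≡ b → Position w
      is-x  : w ≡ x → Position w
      is-y  : w ≡ y → Position w
      is-z  : w ≡ z → Position w
      other : w ≢ b → w ≢ x → w ≢ y → w ≢ z → Position w

    position : ∀ w → Position w
    position w with w ≟ b | w ≟ x | w ≟ y | w ≟ z
    ... | yes p | _     | _     | _     = is-b p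
    ... | no _  | yes p | _     | _     = is-x p
    ... | no _  | no _  | yes p | _     = is-y p
    ... | no _  | no _  | no _  | yes p = is-z p
    ... | no p  | no q  | no r  | no s  = other p q r s

    rotate-fixed : ∀ w → h′ w ≡ w → h w ≡ w
    rotate-fixed w fixed with position w
    ... | is-b refl     = contradiction (trans (sym at-b) fixed) z≢b
    ... | is-x refl     = contradiction (trans (sym at-x) fixed) y≢x
    ... | is-y refl     = contradiction (trans (sym fixed) at-y) y≢x
    ... | is-z refl     = contradiction (trans (sym fixed) at-z) z≢b
    ... | other p q r s = trans (sym (elsewhere p q r s)) fixed

    -- The one pair that may fail to be an edge moves from `b`, `x` to `b`, `z`: the pair `x`, `y`
    -- is an edge by assumption, and the pairs away from these four vertices are old edges.
    rotate-matching : E x y → Matching (AddEdge E b z) h′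
    rotate-matching Exy .involutive w = trans
      (cong (transpose b y ∘ h) (transpose-involutive b y (h (transpose b y w))))
      (trans (cong (transpose b y) (M .involutive (transpose b y w))) (transpose-involutive b y w))
    rotate-matching Exy .edge w moves with position w
    ... | is-b refl     = inj₂ (inj₁ (refl , at-b))
    ... | is-x refl     = inj₁ (subst (E w) (sym at-x) Exy)
    ... | is-y refl     = inj₁ (subst (E w) (sym at-y) (E-sym Exy))
    ... | is-z refl     = inj₂ (inj₂ (refl , at-z))
    ... | other p q r s rewrite elsewhere p q r s = inj₁ (oldEdge E p q (M .edge w moves))

  -- Deleting vertices keeps the vertex type and confines the edges to `W`, so that a matching fixes
  -- all vertices outside `W`.
  record GraphOn (W : Pred V 0ℓ) : Set₁ where
    field
      E       : Rel V 0ℓ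
      E?      : ∀ u v → Dec (E u v)
      E-sym   : ∀ {u v} → E u v → E v u
      E-irr   : ∀ {v} → ¬ E v v
      E-in    : ∀ {u v} → E u v → W u

  open GraphOn

  module _ {W : Pred V 0ℓ} where

    addEdge : (G : GraphOn W) → ∀ {a c} → W a → W c → a ≢ c → GraphOn W
    addEdge G {a} {c} wa wc a≢c = record
      { E     = AddEdge (G .E) a c
      ; E?    = λ u v → G .E? u v ⊎-dec ((u ≟ a ×-dec v ≟ c) ⊎-dec (u ≟ c ×-dec v ≟ a))
      ; E-sym = λ { (inj₁ e) → inj₁ (G .E-sym e)
                  ; (inj₂ (inj₁ (p , q))) → inj₂ (inj₂ (q , p))
                  ; (inj₂ (inj₂ (p , q))) → inj₂ (inj₁ (q , p)) }
      ; E-irr = λ { (inj₁ e) → G .E-irr e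
                  ; (inj₂ (inj₁ (refl , q))) → a≢c q
                  ; (inj₂ (inj₂ (refl , q))) → a≢c (sym q) }
      ; E-in  = λ { (inj₁ e) → G .E-in e
                  ; (inj₂ (inj₁ (refl , _))) → wa
                  ; (inj₂ (inj₂ (refl , _))) → wc }
      }

    PerfectMatching : Rel V 0ℓ → (V → V) → Set
    PerfectMatching F h = Matching F h × (∀ w → W w → h w ≢ w)

    -- h is perfect except that it uses the pair b x, which need not be an edge.
    -- Rotating that pair along f makes h agree with f in more places, and stops
    -- at the latest when x is one of a and c.
    exchange : (G : GraphOn W) → ∀ {a b c} → G .E b a → G .E b c →
               ∀ {f} → PerfectMatching (AddEdge (G .E) a c) f →
               ∀ x h → W x → PerfectMatching (AddEdge (G .E) b x) h → h b ≡ x →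
               Acc _<_ (count λ v → ¬? (h v ≟ f v)) →
               ∃ (PerfectMatching (G .E))
    exchange G {a} {b} {c} Eba Ebc {f} (Mf , pf) x h Wx (Mh , ph) hb≡x (acc rec)
      with G .E? b x
    ... | yes Ebx = h , absorb (G .E-sym) Ebx Mh , ph
    ... | no ¬Ebx = exchange G Eba Ebc (Mf , pf) (h y) (rotate b y h) Wz
      (rotate-matching Exy , λ w ww fixed → ph w ww (rotate-fixed w fixed)) at-b
      (rec (count-mono-< (λ v → ¬? (rotate b y h v ≟ f v)) (λ v → ¬? (h v ≟ f v))
              closer x (λ differs → differs at-x) x-differs))
      where
      -- Since `b x` is no edge, `x` is neither `a` nor `c`; hence its pair in `f` is an edge of
      -- `G`, and the rotation makes `h` adopt it.
      y = f x

      Wb : W b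
      Wb = G .E-in Eba

      x≢b : x ≢ b
      x≢b x≡b = ph b Wb (trans hb≡x x≡b)

      x≢a : x ≢ a
      x≢a refl = ¬Ebx Eba

      x≢c : x ≢ c
      x≢c refl = ¬Ebx Ebc

      y≢x : y ≢ x
      y≢x = pf x Wx

      Exy : G .E x y
      Exy = oldEdge (G .E) x≢a x≢c (Mf .edge x y≢x)

      y≢b : y ≢ b
      y≢b y≡b = ¬Ebx (G .E-sym (subst (G .E x) y≡b Exy))

      hy≢y : h y ≢ y
      hy≢y = ph y (G .E-in (G .E-sym Exy))

      Wz : W (h y)
      Wz = G .E-in (G .E-sym (oldEdge (G .E) y≢b y≢x (Mh .edge y hy≢y)))

      open Rotation (G .E-sym) Mh hb≡x x≢b y≢b y≢x hy≢y

      x-differs : h x ≢ y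
      x-differs hx≡y = y≢b (trans (sym hx≡y) (flip Mh hb≡x))

      -- The broken pairs `b`, `x` and `y`, `h y` do not occur in `f`, which pairs `x` with `y`; so
      -- no agreement is lost.
      closer : ∀ v → rotate b y h v ≢ f v → h v ≢ f v
      closer v differs with position v
      ... | is-b refl     = λ hb≡fb → y≢b (flip Mf (trans (sym hb≡fb) hb≡x))
      ... | is-x refl     = contradiction at-x differs
      ... | is-y refl     = contradiction (trans at-y (sym (Mf .involutive x))) differs
      ... | is-z refl     = λ hz≡fz → x-differs (flip Mh (injective Mf (trans (sym hz≡fz) (Mh .involutive y))))
      ... | other p q r s = λ hv≡fv → differs (trans (elsewhere p q r s) hv≡fv)

-- Augmenting paths of length one, three and five

unmatched : ∀ {n} → (Fin n → Fin n) → ℕ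
unmatched h = count λ v → h v ≟ v

module Augmenting {n : ℕ} {W : Pred (Fin n) 0ℓ} (W? : Decidable W) (G : GraphOn W) where

  open GraphOn G

  private
    V = Fin n

  Universal : Pred V 0ℓ
  Universal b = W b × (∀ d → W d → d ≢ b → E b d)

  universal? : Decidable Universal
  universal? b = W? b ×-dec all? λ d → W? d →-dec (¬? (d ≟ b) →-dec E? b d)

  Free : (V → V) → Pred V 0ℓ
  Free h v = W v × h v ≡ v

  free? : ∀ h → Decidable (Free h)
  free? h v = W? v ×-dec h v ≟ v

  Improvement : (V → V) → Set
  Improvement h = ∃[ h′ ] (Matching E h′ × unmatched h′ < unmatched h)

  module _ {h : V → V} (M : Matching E h) {u v : V} (u≢v : u ≢ v)
           (hu≡u : h u ≡ u) (hv≡v : h v ≡ v) where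

    private
      joined  = join-matching M hv≡v hu≡u
      j  = join v u h
      at-v : j v ≡ u
      at-v = join-left M hv≡v hu≡u

      untouched : ∀ {w} → h w ≢ w → j w ≡ h w
      untouched hw≢w = join-other M hv≡v hu≡u (λ { refl → hw≢w hv≡v }) (λ { refl → hw≢w hu≡u })

      -- `v` is fixed by `h` but not by `j`, and the rotations later applied to `j` create no fixed
      -- points.
      improves : ∀ g → (∀ w → g w ≡ w → j w ≡ w) → unmatched g < unmatched h
      improves g fixed = count-mono-< (λ w → g w ≟ w) (λ w → h w ≟ w)
        (λ w gw≡w → proj₁ (j-fixed w (fixed w gw≡w))) v
        (λ gv≡v → proj₂ (j-fixed v (fixed v gv≡v)) refl) hv≡v
        where j-fixed = join-fixed M hv≡v hu≡u (u≢v ∘ sym)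

    augment₀ : E u v → Improvement h
    augment₀ Euv = j , absorb E-sym (E-sym Euv) joined , improves j λ _ → id

    module _ {x : V} (hx≢x : h x ≢ x) (Eux : E u x) where

      private
        x≢v : x ≢ v
        x≢v refl = hx≢x hv≡v

        x≢u : x ≢ u
        x≢u refl = hx≢x hu≡u

        jx≢x : j x ≢ x
        jx≢x jx≡x = hx≢x (trans (sym (untouched hx≢x)) jx≡x)

        module R = Rotation E-sym joined at-v u≢v x≢v x≢u jx≢x
        g = rotate v x j
        y = j x

        y≡hx : y ≡ h x
        y≡hx = untouched hx≢x

      -- The augmenting path is `u`, `x`, `h x`, `v`. After `u` and `v` are joined as if adjacent,
      -- one rotation trades the pairs `v`, `u` and `x`, `h x` for `u`, `x` and `v`, `h x`.
      augment₁ : E v (h x) → Improvement h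
      augment₁ Evhx = g , absorb E-sym (subst (E v) (sym y≡hx) Evhx) (R.rotate-matching Eux)
                        , improves g R.rotate-fixed

      -- The augmenting path is `u`, `x`, `h x`, `h x′`, `x′`, `v`: a second rotation at `v` moves
      -- the doubtful pair on to `v`, `x′`.
      augment₂ : ∀ {x′} → h x′ ≢ x′ → x ≢ x′ → h x ≢ x′ →
                 E v x′ → E (h x) (h x′) → Improvement h
      augment₂ {x′} hx′≢x′ x≢x′ hx≢x′ Evx′ Ehxhx′ =
        rotate v y′ g ,
        absorb E-sym (subst (E v) (sym gy′≡x′) Evx′) (R′.rotate-matching (subst (λ z → E z y′) (sym y≡hx) Ehxhx′)) ,
        improves (rotate v y′ g) (λ w → R.rotate-fixed w ∘ R′.rotate-fixed w)
        where
        y′ = h x′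
        hy′≢y′ : h y′ ≢ y′
        hy′≢y′ = moved M hx′≢x′
        y′≢v : y′ ≢ v
        y′≢v y′≡v = hy′≢y′ (subst (λ z → h z ≡ z) (sym y′≡v) hv≡v)
        y′≢u : y′ ≢ u
        y′≢u y′≡u = hy′≢y′ (subst (λ z → h z ≡ z) (sym y′≡u) hu≡u)
        y′≢x : y′ ≢ x
        y′≢x y′≡x = hx≢x′ (flip M y′≡x)
        y′≢y : y′ ≢ y
        y′≢y y′≡y = x≢x′ (sym (injective M (trans y′≡y y≡hx)))
        gy′≡x′ : g y′ ≡ x′
        gy′≡x′ = trans (R.elsewhere y′≢v y′≢u y′≢x y′≢y)
                       (trans (untouched hy′≢y′) (M .involutive x′))
        gy′≢y′ : g y′ ≢ y′
        gy′≢y′ gy′≡y′ = hx′≢x′ (trans (sym gy′≡y′) gy′≡x′)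
        y≢v : y ≢ v
        y≢v y≡v = moved M hx≢x (subst (λ z → h z ≡ z) (trans (sym y≡v) y≡hx) hv≡v)
        module R′ = Rotation E-sym (R.rotate-matching Eux) R.at-b y≢v y′≢v y′≢y gy′≢y′

  -- Matchings without short augmenting paths

  record Blocked (h : V → V) : Set where
    field
      matching   : Matching E h
      u₀ v₀      : V
      u₀-free    : Free h u₀
      v₀-free    : Free h v₀
      u₀≢v₀      : u₀ ≢ v₀
      no-augment₀ : ∀ {u v} → Free h u → Free h v → u ≢ v → ¬ E u v
      no-augment₁ : ∀ {u v x} → Free h u → Free h v → u ≢ v → h x ≢ x → E u x → ¬ E v (h x)

    another-free : ∀ v → ∃[ w ] (Free h w × w ≢ v)
    another-free v with v ≟ u₀
    ... | yes refl = v₀ , v₀-free , u₀≢v₀ ∘ sym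
    ... | no v≢u₀  = u₀ , u₀-free , v≢u₀ ∘ sym

    free-not-universal : ∀ {v} → Free h v → ¬ Universal v
    free-not-universal {v} free (_ , univ) with another-free v
    ... | w , w-free , w≢v = no-augment₀ free w-free (w≢v ∘ sym) (univ w (proj₁ w-free) w≢v)

    universal-moved : ∀ {x} → Universal x → h x ≢ x
    universal-moved U@(Wx , _) hx≡x = free-not-universal (Wx , hx≡x) U

    free-to-universal : ∀ {v x} → Free h v → Universal x → E v x
    free-to-universal {v} free U@(_ , univ) =
      E-sym (univ v (proj₁ free) λ { refl → free-not-universal free U })

    -- Otherwise a second free vertex `w` starts the augmenting path `w`, `x`, `h x`, `v`.
    free-to-partner : ∀ {v x} → Free h v → Universal x → ¬ E v (h x)
    free-to-partner {v} free U with another-free v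
    ... | w , w-free , w≢v =
      no-augment₁ w-free free w≢v (universal-moved U) (free-to-universal w-free U)

    partner-not-universal : ∀ {x} → Universal x → ¬ Universal (h x)
    partner-not-universal U U′ = free-to-partner u₀-free U (free-to-universal u₀-free U′)

  record Barrier (h : V → V) : Set where
    field
      blocked     : Blocked h
      no-augment₂ : ∀ {x x′} → Universal x → Universal x′ → x ≢ x′ → ¬ E (h x) (h x′)
    open Blocked blocked public

  -- Free vertices are adjacent to all universal ones, so an edge between the partners of two
  -- universal vertices completes an augmenting path of length five from `u₀` to `v₀`.
  improve-blocked : ∀ {h} → Blocked h → Improvement h ⊎ Barrier h
  improve-blocked {h} blocked
    with any? (λ x → any? λ x′ →
           universal? x ×-dec (universal? x′ ×-dec (¬? (x ≟ x′) ×-dec E? (h x) (h x′))))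
  ... | yes (x , x′ , U , U′ , x≢x′ , Ehxhx′) = inj₁
    (augment₂ matching u₀≢v₀ (proj₂ u₀-free) (proj₂ v₀-free)
      (universal-moved U) (free-to-universal u₀-free U)
      (universal-moved U′) x≢x′ (λ hx≡x′ → partner-not-universal U (subst Universal (sym hx≡x′) U′))
      (free-to-universal v₀-free U′) Ehxhx′)
    where open Blocked blocked
  ... | no ¬aug₂ = inj₂ (record
    { blocked = blocked
    ; no-augment₂ = λ {x} {x′} U U′ x≢x′ e → ¬aug₂ (x , x′ , U , U′ , x≢x′ , e) })

  improve : ∀ {h} → Matching E h → ∀ {u v} → Free h u → Free h v → u ≢ v →
            Improvement h ⊎ Barrier h
  improve {h} M u₀-free v₀-free u₀≢v₀
    with any? (λ u → any? λ v → free? h u ×-dec (free? h v ×-dec (¬? (u ≟ v) ×-dec E? u v)))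
  ... | yes (u , v , (_ , hu) , (_ , hv) , u≢v , Euv) = inj₁ (augment₀ M u≢v hu hv Euv)
  ... | no ¬aug₀
    with any? (λ u → any? λ v → any? λ x →
           free? h u ×-dec (free? h v ×-dec (¬? (u ≟ v) ×-dec
             (¬? (h x ≟ x) ×-dec (E? u x ×-dec E? v (h x))))))
  ... | yes (u , v , x , (_ , hu) , (_ , hv) , u≢v , hx≢x , Eux , Evhx) =
    inj₁ (augment₁ M u≢v hu hv hx≢x Eux Evhx)
  ... | no ¬aug₁ = improve-blocked (record
    { matching = M ; u₀-free = u₀-free ; v₀-free = v₀-free ; u₀≢v₀ = u₀≢v₀
    ; no-augment₀ = λ {u} {v} fu fv u≢v e → ¬aug₀ (u , v , fu , fv , u≢v , e)
    ; no-augment₁ = λ {u} {v} {x} fu fv u≢v m e e′ → ¬aug₁ (u , v , x , fu , fv , u≢v , m , e , e′) })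

  -- A clique is a component of the graph left after deleting the universal vertices.
  module Counting
    (clique : ∀ {a b c} → W b → ¬ Universal b → E b a → E b c → a ≢ c → E a c)
    {h : V → V} (B : Barrier h) where

    open Barrier B

    Outer : Pred V 0ℓ
    Outer v = W v × ¬ Universal v

    outer? : Decidable Outer
    outer? v = W? v ×-dec ¬? (universal? v)

    -- One vertex of each odd clique.
    Root : Pred V 0ℓ
    Root v = W v × (h v ≡ v ⊎ Universal (h v))

    root? : Decidable Root
    root? v = W? v ×-dec (h v ≟ v ⊎-dec universal? (h v))

    root-outer : ∀ {v} → Root v → Outer v
    root-outer (Wv , inj₁ hv≡v) = Wv , free-not-universal (Wv , hv≡v)
    root-outer {v} (Wv , inj₂ U)    = Wv , λ Uv →
      partner-not-universal U (subst Universal (sym (matching .involutive v)) Uv)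

    -- An edge between two roots would complete an augmenting path of length one, three or five,
    -- according to how many of the two are partners of universal vertices.
    roots-independent : ∀ {u v} → Root u → Root v → ¬ E u v
    roots-independent {u} {v} (Wu , inj₁ hu) (Wv , inj₁ hv) Euv =
      no-augment₀ (Wu , hu) (Wv , hv) (λ { refl → E-irr Euv }) Euv
    roots-independent {u} {v} (Wu , inj₁ hu) (Wv , inj₂ Uv) Euv =
      free-to-partner (Wu , hu) Uv (subst (E u) (sym (matching .involutive v)) Euv)
    roots-independent {u} {v} (Wu , inj₂ Uu) (Wv , inj₁ hv) Euv =
      free-to-partner (Wv , hv) Uu (subst (E v) (sym (matching .involutive u)) (E-sym Euv))
    roots-independent {u} {v} (Wu , inj₂ Uu) (Wv , inj₂ Uv) Euv =
      no-augment₂ Uu Uv (λ hu≡hv → E-irr (subst (E u) (sym (injective matching hu≡hv)) Euv))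
        (subst₂ E (sym (matching .involutive u)) (sym (matching .involutive v)) Euv)

    Neighbour : V → Pred V 0ℓ
    Neighbour v w = E v w × ¬ Universal w

    neighbour? : ∀ v → Decidable (Neighbour v)
    neighbour? v w = E? v w ×-dec ¬? (universal? w)

    Clique : V → Pred V 0ℓ
    Clique v w = Outer w × (w ≡ v ⊎ E v w)

    clique? : ∀ v → Decidable (Clique v)
    clique? v w = outer? w ×-dec (w ≟ v ⊎-dec E? v w)

    clique-closed : ∀ {v w z} → Clique v w → Outer z → E w z → Clique v z
    clique-closed (_ , inj₁ refl) Oz Ewz = Oz , inj₂ Ewz
    clique-closed {v} {w} {z} ((Ww , ¬Uw) , inj₂ Evw) Oz Ewz with z ≟ v
    ... | yes z≡v = Oz , inj₁ z≡v
    ... | no z≢v  = Oz , inj₂ (clique Ww ¬Uw (E-sym Evw) Ewz (z≢v ∘ sym))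

    -- A shared vertex puts both roots into one clique, where they are equal or adjacent.
    cliques-disjoint : ∀ u v w → Root u → Root v → Clique u w → Clique v w → u ≡ v
    cliques-disjoint u v w Ru Rv Cu (Ow , inj₁ refl) = lemma Cu
      where
      lemma : Clique u w → u ≡ w
      lemma (_ , inj₁ w≡u) = sym w≡u
      lemma (_ , inj₂ Euw) = contradiction Euw (roots-independent Ru Rv)
    cliques-disjoint u v w Ru Rv Cu (Ow , inj₂ Evw)
      with clique-closed Cu (root-outer Rv) (E-sym Evw)
    ... | _ , inj₁ v≡u = sym v≡u
    ... | _ , inj₂ Euv = contradiction Euv (roots-independent Ru Rv)

    Isolated : Pred V 0ℓ
    Isolated v = Root v × ¬ ∃ (Neighbour v)

    isolated? : Decidable Isolated
    isolated? v = root? v ×-dec ¬? (any? (neighbour? v))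

    Big : Pred V 0ℓ
    Big v = Root v × ∃ (Neighbour v)

    big? : Decidable Big
    big? v = root? v ×-dec any? (neighbour? v)

    Rest : Pred V 0ℓ
    Rest v = Outer v × ¬ Root v

    rest? : Decidable Rest
    rest? v = outer? v ×-dec ¬? (root? v)

    neighbour-rest : ∀ v w → Root v → Neighbour v w → Rest w
    neighbour-rest v w Rv (Evw , ¬Uw) = (E-in (E-sym Evw) , ¬Uw) , λ Rw → roots-independent Rv Rw Evw

    -- A neighbour `x` of `v` in the clique is no root, so its partner is not universal and lies in
    -- the same clique. That partner is not `v`, because a root is free or paired with a universal
    -- vertex.
    big-clique : ∀ v → Big v → 2 ≤ count (neighbour? v)
    big-clique v (Rv , x , Evx , ¬Ux) = 2≤count (neighbour? v) (hx≢x ∘ sym) (Evx , ¬Ux) (Evhx , ¬Uhx)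
      where
      ¬Rx : ¬ Root x
      ¬Rx = proj₂ (neighbour-rest v x Rv (Evx , ¬Ux))
      Wx : W x
      Wx = E-in (E-sym Evx)
      hx≢x : h x ≢ x
      hx≢x hx≡x = ¬Rx (Wx , inj₁ hx≡x)
      ¬Uhx : ¬ Universal (h x)
      ¬Uhx Uhx = ¬Rx (Wx , inj₂ Uhx)
      v≢hx : v ≢ h x
      v≢hx refl = notRoot Rv
        where
        notRoot : ¬ Root (h x)
        notRoot (_ , inj₁ fixed) = moved matching hx≢x fixed
        notRoot (_ , inj₂ U) = ¬Ux (subst Universal (matching .involutive x) U)
      Evhx : E v (h x)
      Evhx = clique Wx ¬Ux (E-sym Evx) (matching .edge x hx≢x) v≢hx

    private
      q = count root?
      i = count isolated?
      x = count outer?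
      u = count universal?

    -- The roots are the free vertices, at least two, and the partners of the universal vertices, as
    -- many as these.
    roots-count : 2 + u ≤ q
    roots-count = begin
      2 + u
        ≤⟨ +-mono-≤ (2≤count (free? h) u₀≢v₀ u₀-free v₀-free)
             (≤-reflexive (sym (count-involution universal? h (matching .involutive)))) ⟩
      count (free? h) + count (universal? ∘ h)
        ≡⟨ count-partition (free? h) (universal? ∘ h) root?
             (λ { v (Wv , inj₁ hv) → inj₁ (Wv , hv) ; v (Wv , inj₂ U) → inj₂ U })
             (λ { v (Wv , hv) → Wv , inj₁ hv })
             (λ v U → W-partner U , inj₂ U)
             (λ v free U → free-not-universal free (subst Universal (proj₂ free) U)) ⟨
      q ∎
      where
      open ≤-Reasoning
      W-partner : ∀ {v} → Universal (h v) → W v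
      W-partner {v} U = E-in (matching .edge v
        λ hv≡v → free-not-universal (subst W hv≡v (proj₁ U) , hv≡v) (subst Universal hv≡v U))

    -- Each big clique contributes two vertices besides its root, and different cliques share none.
    outer-count : q + 2 * count big? ≤ x
    outer-count = begin
      q + 2 * count big?
        ≡⟨ cong (λ z → q + z) (*-comm 2 (count big?)) ⟩
      q + count big? * 2
        ≤⟨ +-monoʳ-≤ q (count-family big? rest? neighbour?
             (λ v w big → neighbour-rest v w (proj₁ big))
             (λ v v′ w big big′ N N′ → cliques-disjoint v v′ w (proj₁ big) (proj₁ big′)
                (neighbour-clique N) (neighbour-clique N′))
             2 0 1 λ v big → ≤-trans (big-clique v big) (≤-reflexive (sym (+-identityʳ _)))) ⟩
      q + (count big? * 0 + 1 * count rest?)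
        ≡⟨ cong (λ z → q + z) (cong₂ _+_ (*-zeroʳ (count big?)) (*-identityˡ _)) ⟩
      q + count rest?
        ≡⟨ count-partition root? rest? outer? split (λ _ → root-outer) (λ _ → proj₁)
             (λ v R rest → proj₂ rest R) ⟨
      x ∎
      where
      open ≤-Reasoning
      neighbour-clique : ∀ {v w} → Neighbour v w → Clique v w
      neighbour-clique (Evw , ¬Uw) = (E-in (E-sym Evw) , ¬Uw) , inj₂ Evw
      split : ∀ v → Outer v → Root v ⊎ Rest v
      split v Ov with root? v
      ... | yes R = inj₁ R
      ... | no ¬R = inj₂ (Ov , ¬R)

    root-split : q ≡ i + count big?
    root-split = count-partition isolated? big? root? split (λ _ → proj₁) (λ _ → proj₁)
      λ v isolated big → proj₂ isolated (proj₂ big)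
      where
      split : ∀ v → Root v → Isolated v ⊎ Big v
      split v R with any? (neighbour? v)
      ... | yes N = inj₂ (R , N)
      ... | no ¬N = inj₁ (R , ¬N)

    W-split : count W? ≡ u + x
    W-split = count-partition universal? outer? W? split (λ _ → proj₁) (λ _ → proj₁)
      λ v U O → proj₂ O U
      where
      split : ∀ v → W v → Universal v ⊎ Outer v
      split v Wv with universal? v
      ... | yes U = inj₁ U
      ... | no ¬U = inj₂ (Wv , ¬U)

-- Inequalities bounding the order of the graph

module Arithmetic (m ρ : ℕ) where
  open ≤-Reasoning

  -- Here `u`, `x`, `q`, `i` and `c` stand for the numbers of universal vertices, outer vertices,
  -- roots, isolated roots and big roots, and `ρ` for the number of deleted vertices.
  3*-bound : ∀ {u q x i c} → 2 + u ≤ q → q + 2 * c ≤ x → q ≡ i + c → 3 * u + 6 ≤ x + 2 * i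
  3*-bound {u} {q} {x} {i} {c} u<q q≤x refl = begin
    3 * u + 6                ≡⟨ solve (u ∷ []) ⟩
    3 * (2 + u)              ≤⟨ *-monoʳ-≤ 3 u<q ⟩
    3 * (i + c)              ≡⟨ solve (i ∷ c ∷ []) ⟩
    (i + c + 2 * c) + 2 * i  ≤⟨ +-monoˡ-≤ (2 * i) q≤x ⟩
    x + 2 * i                ∎

  -- Adding `m` times `small` to `binding` cancels `u` and leaves `x + m * i + 6 * m ≤ 3 * m * ρ`.
  isolated-bound : ∀ {u x i} → 3 * u + 6 ≤ x + 2 * i →
    (1 + 4 * m) * x + 3 * m * i ≤ 3 * m * (u + x + ρ) → x ≤ 3 * m * ρ
  isolated-bound {u} {x} {i} small binding = ≤-trans (≤-trans (m≤m+n x (m * i)) (m≤m+n (x + m * i) (6 * m)))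
    (+-cancelˡ-≤ (4 * m * x + 3 * m * u + 2 * m * i) _ _ (begin
      (4 * m * x + 3 * m * u + 2 * m * i) + (x + m * i + 6 * m)
        ≡⟨ solve (m ∷ x ∷ u ∷ i ∷ []) ⟩
      ((1 + 4 * m) * x + 3 * m * i) + m * (3 * u + 6)
        ≤⟨ +-mono-≤ binding (*-monoʳ-≤ m small) ⟩
      3 * m * (u + x + ρ) + m * (x + 2 * i)
        ≡⟨ solve (m ∷ x ∷ u ∷ i ∷ ρ ∷ []) ⟩
      (4 * m * x + 3 * m * u + 2 * m * i) + 3 * m * ρ ∎))

  module _ {u x q : ℕ} (0<q : 2 + u ≤ q) (small : 3 * u + 6 ≤ x)
    (summed : q * ((1 + 4 * m) * x) ≤ q * (3 * m * (u + x + ρ)) + (1 + m) * x) where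

    private
      reduced : q * ((1 + m) * x) ≤ 3 * m * q * (u + ρ) + (1 + m) * x
      reduced = +-cancelˡ-≤ (3 * m * q * x) _ _ (begin
        3 * m * q * x + q * ((1 + m) * x)   ≡⟨ solve (m ∷ q ∷ x ∷ []) ⟩
        q * ((1 + 4 * m) * x)               ≤⟨ summed ⟩
        q * (3 * m * (u + x + ρ)) + (1 + m) * x
          ≡⟨ solve (m ∷ q ∷ x ∷ u ∷ ρ ∷ []) ⟩
        3 * m * q * x + (3 * m * q * (u + ρ) + (1 + m) * x) ∎)

      instance
        q≢0 : NonZero q
        q≢0 = >-nonZero (≤-trans (s≤s z≤n) 0<q)

    -- The error term `(1 + m) * x` is at most half of `q * x`; then `small`, taken `2 * m * q`
    -- times, cancels `u` from twice `reduced`.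
    many-bound : 2 * (1 + m) ≤ q → x ≤ 6 * m * ρ
    many-bound many = *-cancelˡ-≤ q (≤-trans (m≤m+n (q * x) (12 * m * q))
      (+-cancelˡ-≤ (q * x + 6 * m * q * u + 2 * m * q * x) _ _ (begin
        (q * x + 6 * m * q * u + 2 * m * q * x) + (q * x + 12 * m * q)
          ≡⟨ solve (m ∷ q ∷ x ∷ u ∷ []) ⟩
        2 * (q * ((1 + m) * x)) + 2 * m * q * (3 * u + 6)
          ≤⟨ +-mono-≤ (*-monoʳ-≤ 2 reduced) (*-monoʳ-≤ (2 * m * q) small) ⟩
        2 * (3 * m * q * (u + ρ) + (1 + m) * x) + 2 * m * q * x
          ≡⟨ solve (m ∷ q ∷ x ∷ u ∷ ρ ∷ []) ⟩
        2 * (1 + m) * x + (6 * m * q * u + 2 * m * q * x + q * (6 * m * ρ))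
          ≤⟨ +-monoˡ-≤ _ (*-monoˡ-≤ x many) ⟩
        q * x + (6 * m * q * u + 2 * m * q * x + q * (6 * m * ρ))
          ≡⟨ solve (m ∷ q ∷ x ∷ u ∷ ρ ∷ []) ⟩
        (q * x + 6 * m * q * u + 2 * m * q * x) + q * (6 * m * ρ) ∎)))

    -- Now `u` is bounded because `u ≤ q`. Of two copies of `reduced`, one left side absorbs both
    -- error terms since `2 ≤ q`.
    few-bound : q ≤ 2 * (1 + m) → x ≤ 6 * (2 * (1 + m) + ρ)
    few-bound few = *-cancelˡ-≤ (1 + m) (*-cancelˡ-≤ q (+-cancelˡ-≤ (q * ((1 + m) * x)) _ _ (begin
      q * ((1 + m) * x) + q * ((1 + m) * x)
        ≤⟨ +-mono-≤ reduced reduced ⟩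
      (3 * m * q * (u + ρ) + (1 + m) * x) + (3 * m * q * (u + ρ) + (1 + m) * x)
        ≡⟨ solve (m ∷ q ∷ x ∷ u ∷ ρ ∷ []) ⟩
      2 * ((1 + m) * x) + 6 * q * (u + ρ) * m
        ≤⟨ +-mono-≤ (*-monoˡ-≤ ((1 + m) * x) (≤-trans (m≤m+n 2 u) 0<q)) (*-monoʳ-≤ (6 * q * (u + ρ)) (n≤1+n m)) ⟩
      q * ((1 + m) * x) + 6 * q * (u + ρ) * (1 + m)
        ≤⟨ +-monoʳ-≤ (q * ((1 + m) * x)) (*-monoˡ-≤ (1 + m) (*-monoʳ-≤ (6 * q)
             (+-monoˡ-≤ ρ (≤-trans (≤-trans (m≤n+m u 2) 0<q) few)))) ⟩
      q * ((1 + m) * x) + 6 * q * (2 * (1 + m) + ρ) * (1 + m)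
        ≡⟨ solve (m ∷ q ∷ x ∷ ρ ∷ []) ⟩
      q * ((1 + m) * x) + q * ((1 + m) * (6 * (2 * (1 + m) + ρ))) ∎)))

  -- The sum of the bounds for many and for few odd cliques; it also exceeds the bound for isolated
  -- roots.
  outerBound : ℕ
  outerBound = 6 * m * ρ + 6 * (2 * (1 + m) + ρ)

  -- Twice `outerBound` suffices for `u + x` because `u ≤ q ≤ x`.
  vertexBound : ℕ
  vertexBound = 2 * outerBound + ρ

  isolated≤ : 3 * m * ρ ≤ outerBound
  isolated≤ = ≤-trans (*-monoˡ-≤ ρ (*-monoˡ-≤ m (m≤n+m 3 3))) (m≤m+n _ _)

  total-bound : ∀ {u q x c} → 2 + u ≤ q → q + 2 * c ≤ x → x ≤ outerBound → u + x + ρ ≤ vertexBound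
  total-bound {u} {q} {x} {c} u<q q≤x x≤ = +-monoˡ-≤ ρ (begin
    u + x            ≤⟨ +-monoˡ-≤ x (≤-trans (≤-trans (m≤n+m u 2) u<q) (≤-trans (m≤m+n q (2 * c)) q≤x)) ⟩
    x + x            ≡⟨ solve (x ∷ []) ⟩
    2 * x            ≤⟨ *-monoʳ-≤ 2 x≤ ⟩
    2 * outerBound   ∎)

-- Parity of the number of matched vertices

double-divides : ∀ a → 2 ∣ a + a
double-divides a = divides a (solve (a ∷ []))

-- The involution exchanges the points below their images with the points above them, so both kinds
-- are equally many.
moved-even : ∀ {n} (h : Fin n → Fin n) → (∀ v → h (h v) ≡ v) → 2 ∣ count (λ v → ¬? (h v ≟ v))
moved-even h inv = subst (2 ∣_) (sym (trans
  (count-partition up? down? (λ v → ¬? (h v ≟ v)) split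
    (λ { v v<hv hv≡v → Finₚ.<⇒≢ v<hv (sym hv≡v) })
    (λ { v hv<v hv≡v → Finₚ.<⇒≢ hv<v hv≡v })
    (λ v → Finₚ.<-asym))
  (cong (_+ count down?) (trans
    (count-cong up? (down? ∘ h) (λ v → subst (Fin._< h v) (sym (inv v))) (λ v → subst (Fin._< h v) (inv v)))
    (count-involution down? h inv)))))
  (double-divides (count down?))
  where
  up? : Decidable (λ v → v Fin.< h v)
  up? v = v Finₚ.<? h v
  down? : Decidable (λ v → h v Fin.< v)
  down? v = h v Finₚ.<? v
  split : ∀ v → h v ≢ v → v Fin.< h v ⊎ h v Fin.< v
  split v hv≢v with Finₚ.<-cmp v (h v)
  ... | tri< v<hv _ _ = inj₁ v<hv
  ... | tri≈ _ v≡hv _ = contradiction (sym v≡hv) hv≢v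
  ... | tri> _ _ hv<v = inj₂ hv<v

-- |N(X)| ≥ (4/3 + 1/(3m)) |X|, applied to sets X and Y with no edge between
-- them, where |N(X)| ≤ n - |Y|.
Binding : ∀ {n} → Pred (Fin n) 0ℓ → ℕ → Rel (Fin n) 0ℓ → Set₁
Binding {n} W m E = ∀ {X Y : Pred (Fin n) 0ℓ} (X? : Decidable X) (Y? : Decidable Y) → ∃ X → ∃ Y →
  (∀ v → X v → W v) → (∀ v → Y v → W v) → (∀ u v → X u → Y v → ¬ E u v) →
  (1 + 4 * m) * count X? + 3 * m * count Y? ≤ 3 * m * n

-- Perfect matchings by induction on the number of non-edges

module _ {n : ℕ} {W : Pred (Fin n) 0ℓ} (W? : Decidable W) where

  private
    V = Fin n

  open GraphOn

  -- The moved vertices lie in `W` and are even in number, so the number of free vertices is even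
  -- and cannot be one.
  second-free : 2 ∣ count W? → (G : GraphOn W) → ∀ {h} → Matching (G .E) h →
                let open Augmenting W? G in
                ∀ {u} → Free h u → ∃[ v ] (Free h v × u ≢ v)
  second-free even G {h} M {u} u-free with any? (λ v → Augmenting.free? W? G h v ×-dec ¬? (u ≟ v))
  ... | yes found = found
  ... | no ¬found = contradiction (∣⇒≤ 2∣1) λ { (s≤s ()) }
    where
    open Augmenting W? G
    split : ∀ v → W v → h v ≢ v ⊎ Free h v
    split v Wv with h v ≟ v
    ... | yes hv≡v = inj₂ (Wv , hv≡v)
    ... | no hv≢v  = inj₁ hv≢v
    only-u : ∀ v → Free h v → v ≡ u
    only-u v v-free with u ≟ v
    ... | yes u≡v = sym u≡v
    ... | no u≢v  = contradiction (v , v-free , u≢v) ¬found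
    2∣free : 2 ∣ count (free? h)
    2∣free = ∣m+n∣m⇒∣n
      (subst (2 ∣_) (count-partition (λ v → ¬? (h v ≟ v)) (free? h) W? split
        (λ v hv≢v → G .E-in (M .edge v hv≢v)) (λ _ → proj₁) (λ v hv≢v free → hv≢v (proj₂ free))) even)
      (moved-even h (M .involutive))
    2∣1 : 2 ∣ 1
    2∣1 = subst (2 ∣_) (≤-antisym
      (count-unique (free? h) λ v w p q → trans (only-u v p) (sym (only-u w q)))
      (1≤count (free? h) u-free)) 2∣free

  module Existence (m ρ : ℕ) (size : count W? + ρ ≡ n) (even : 2 ∣ count W?)
                   (large : Arithmetic.vertexBound m ρ < n) where

    open Arithmetic m ρ

    Cliques : GraphOn W → Set
    Cliques G = ∀ {a b c} → W b → ¬ Augmenting.Universal W? G b →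
                G .E b a → G .E b c → a ≢ c → G .E a c

    no-barrier : (G : GraphOn W) → Binding W m (G .E) → Cliques G →
                 ∀ {h} → ¬ Augmenting.Barrier W? G h
    no-barrier G bind clique B = <⇒≱ large (≤-trans (≤-reflexive (sym total))
      (total-bound {c = count big?} roots-count outer-count outer≤))
      where
      open Augmenting W? G
      open Counting clique B
      open Barrier B

      total : count universal? + count outer? + ρ ≡ n
      total = trans (cong (_+ ρ) (sym W-split)) size

      small : 3 * count universal? + 6 ≤ count outer? + 2 * count isolated?
      small = 3*-bound {i = count isolated?} {c = count big?} roots-count outer-count root-split

      outer≤-isolated : ∃ Isolated → count outer? ≤ outerBound
      outer≤-isolated (v , isolated) = ≤-trans
        (isolated-bound {i = count isolated?} small
          (subst (λ z → (1 + 4 * m) * count outer? + 3 * m * count isolated? ≤ 3 * m * z) (sym total)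
            (bind outer? isolated? (v , root-outer (proj₁ isolated)) (v , isolated)
              (λ _ → proj₁) (λ _ → proj₁ ∘ proj₁)
              λ { u w (_ , ¬Uu) (_ , alone) Euw → alone (u , G .E-sym Euw , ¬Uu) })))
        isolated≤

      outer≤-big : (∀ v → ¬ Isolated v) → count outer? ≤ outerBound
      outer≤-big none = cases (≤-total (2 * (1 + m)) (count root?))
        where
        small′ : 3 * count universal? + 6 ≤ count outer?
        small′ = ≤-trans small (≤-reflexive
          (trans (cong (λ z → count outer? + 2 * z) (count-none isolated? none)) (+-identityʳ _)))

        -- The binding condition for the clique and the outer vertices beyond it; raising the
        -- coefficient of the clique from `3 * m` to `1 + 4 * m` costs `1 + m` for each of its
        -- vertices.
        clique-bound : ∀ v → Root v →
          (1 + 4 * m) * count outer? ≤ 3 * m * n + (1 + m) * count (clique? v)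
        clique-bound v R = begin
          (1 + 4 * m) * count outer?
            ≡⟨ cong ((1 + 4 * m) *_) (count-partition others? (clique? v) outer? split
                 (λ _ → proj₁) (λ _ → proj₁) (λ _ → proj₂)) ⟩
          (1 + 4 * m) * (x + c)
            ≡⟨ regroup x c ⟩
          ((1 + 4 * m) * x + 3 * m * c) + (1 + m) * c
            ≤⟨ +-monoˡ-≤ ((1 + m) * c)
                 (bind others? (clique? v) another (v , root-outer R , inj₁ refl)
                   (λ _ → proj₁ ∘ proj₁) (λ _ → proj₁ ∘ proj₁)
                   λ { u w (Ou , ¬Cu) Cw Euw → ¬Cu (clique-closed Cw Ou (G .E-sym Euw)) }) ⟩
          3 * m * n + (1 + m) * c ∎
          where
          open ≤-Reasoning
          others? : Decidable (λ w → Outer w × ¬ Clique v w)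
          others? w = outer? w ×-dec ¬? (clique? v w)
          x = count others?
          c = count (clique? v)
          regroup : ∀ x c → (1 + 4 * m) * (x + c) ≡ ((1 + 4 * m) * x + 3 * m * c) + (1 + m) * c
          regroup x c = solve (m ∷ x ∷ c ∷ [])
          split : ∀ w → Outer w → (Outer w × ¬ Clique v w) ⊎ Clique v w
          split w Ow with clique? v w
          ... | yes C = inj₂ C
          ... | no ¬C = inj₁ (Ow , ¬C)
          -- The set X has to be nonempty: a second free vertex is a root too, hence lies in another
          -- clique.
          another : ∃ λ w → Outer w × ¬ Clique v w
          another with another-free v
          ... | w , (Ww , hw≡w) , w≢v = w , root-outer R′ , λ
            { (_ , inj₁ w≡v) → w≢v w≡v ; (_ , inj₂ Evw) → roots-independent R R′ Evw }
            where
            R′ : Root w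
            R′ = Ww , inj₁ hw≡w

        summed : count root? * ((1 + 4 * m) * count outer?) ≤
                 count root? * (3 * m * (count universal? + count outer? + ρ)) + (1 + m) * count outer?
        summed = subst (λ z → count root? * ((1 + 4 * m) * count outer?) ≤
                             count root? * (3 * m * z) + (1 + m) * count outer?) (sym total)
          -- Summed over all roots, the last terms of `clique-bound` stay below
          -- `(1 + m) * count outer?`, as the cliques are disjoint.
          (count-family root? outer? clique? (λ _ _ _ → proj₁) cliques-disjoint
            ((1 + 4 * m) * count outer?) (3 * m * n) (1 + m) clique-bound)

        cases : 2 * (1 + m) ≤ count root? ⊎ count root? ≤ 2 * (1 + m) → count outer? ≤ outerBound
        cases (inj₁ many) = ≤-trans (many-bound roots-count small′ summed many) (m≤m+n _ _)
        cases (inj₂ few)  = ≤-trans (few-bound roots-count small′ summed few) (m≤n+m _ _)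

      outer≤ : count outer? ≤ outerBound
      outer≤ with any? isolated?
      ... | yes found = outer≤-isolated found
      ... | no ¬found = outer≤-big λ v isolated → ¬found (v , isolated)

    -- While a free vertex is left, parity provides a second one; as barriers are excluded, the
    -- matching can be improved.
    perfect-from-cliques : (G : GraphOn W) → Binding W m (G .E) → Cliques G →
      ∀ h → Matching (G .E) h → Acc _<_ (unmatched h) → ∃ (PerfectMatching (G .E))
    perfect-from-cliques G bind clique h M (acc rec) with any? (Augmenting.free? W? G h)
    ... | no ¬free = h , M , λ w Ww hw≡w → ¬free (w , Ww , hw≡w)
    ... | yes (u , u-free) with second-free even G M u-free
    ...   | v , v-free , u≢v with Augmenting.improve W? G M u-free v-free u≢v
    ...     | inj₁ (h′ , M′ , fewer) = perfect-from-cliques G bind clique h′ M′ (rec fewer)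
    ...     | inj₂ B = ⊥-elim (no-barrier G bind clique B)

    -- Counts ordered pairs over all vertices, the diagonal included; it serves as a measure that
    -- drops with each added edge.
    nonEdges : GraphOn W → ℕ
    nonEdges G = sum λ u → count λ v → ¬? (G .E? u v)

    addEdge-nonEdges : ∀ G {a c} (Wa : W a) (Wc : W c) (a≢c : a ≢ c) → ¬ G .E a c →
                       nonEdges (addEdge G Wa Wc a≢c) < nonEdges G
    addEdge-nonEdges G {a} {c} Wa Wc a≢c ¬Eac = sum-mono-<
      (λ u → count-mono-≤ (new? u) (old? u) λ _ ¬E′ e → ¬E′ (inj₁ e)) a
      (count-mono-< (new? a) (old? a) (λ _ ¬E′ e → ¬E′ (inj₁ e)) c
        (λ ¬E′ → ¬E′ (inj₂ (inj₁ (refl , refl)))) ¬Eac)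
      where
      G′ = addEdge G Wa Wc a≢c
      new? : ∀ u → Decidable (λ v → ¬ G′ .E u v)
      new? u v = ¬? (G′ .E? u v)
      old? : ∀ u → Decidable (λ v → ¬ G .E u v)
      old? u v = ¬? (G .E? u v)

    non-neighbour : (G : GraphOn W) → ∀ {b} → W b → ¬ Augmenting.Universal W? G b →
                    ∃[ d ] (W d × b ≢ d × ¬ G .E b d)
    non-neighbour G {b} Wb ¬U with any? (λ d → W? d ×-dec (¬? (b ≟ d) ×-dec ¬? (G .E? b d)))
    ... | yes found = found
    ... | no ¬found = contradiction (Wb , adjacent) ¬U
      where
      adjacent : ∀ d → W d → d ≢ b → G .E b d
      adjacent d Wd d≢b with G .E? b d
      ... | yes Ebd = Ebd
      ... | no ¬Ebd = contradiction (d , Wd , d≢b ∘ sym , ¬Ebd) ¬found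

    perfect : (G : GraphOn W) → Binding W m (G .E) → Acc _<_ (nonEdges G) → ∃ (PerfectMatching (G .E))
    perfect G bind (acc rec)
      with any? (λ b → any? λ a → any? λ c → (W? b ×-dec ¬? (Augmenting.universal? W? G b)) ×-dec
             (G .E? b a ×-dec (G .E? b c ×-dec (¬? (a ≟ c) ×-dec ¬? (G .E? a c)))))
    ... | no ¬found = perfect-from-cliques G bind clique id
      (record { involutive = λ _ → refl ; edge = λ v v≢v → contradiction refl v≢v }) (<-wellFounded _)
      where
      clique : Cliques G
      clique {a} {b} {c} Wb ¬Ub Eba Ebc a≢c with G .E? a c
      ... | yes Eac = Eac
      ... | no ¬Eac = contradiction (b , a , c , (Wb , ¬Ub) , Eba , Ebc , a≢c , ¬Eac) ¬found
    ... | yes (b , a , c , (Wb , ¬Ub) , Eba , Ebc , a≢c , ¬Eac) =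
      combine (non-neighbour G Wb ¬Ub)
      where
      add : ∀ {u v} → W u → W v → u ≢ v → ¬ G .E u v → ∃ (PerfectMatching (AddEdge (G .E) u v))
      add Wu Wv u≢v ¬Euv = perfect (addEdge G Wu Wv u≢v)
        -- With more edges, fewer pairs X, Y have no edge between them, so the condition is
        -- inherited.
        (λ X? Y? ∃X ∃Y X⊆W Y⊆W apart → bind X? Y? ∃X ∃Y X⊆W Y⊆W λ x y Xx Yy → apart x y Xx Yy ∘ inj₁)
        (rec (addEdge-nonEdges G Wu Wv u≢v ¬Euv))

      combine : ∃[ d ] (W d × b ≢ d × ¬ G .E b d) → ∃ (PerfectMatching (G .E))
      combine (d , Wd , b≢d , ¬Ebd)
        with f , PMf ← add (G .E-in (G .E-sym Eba)) (G .E-in (G .E-sym Ebc)) a≢c ¬Eac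
           | g , PMg@(Mg , g-perfect) ← add Wb Wd b≢d ¬Ebd
        -- If `g` avoids the pair `b d`, it is a matching of `G` already; otherwise `b d` is the
        -- doubtful pair that `exchange` removes.
        with g b ≟ d
      ... | yes gb≡d = exchange G Eba Ebc PMf d g Wd PMg gb≡d (<-wellFounded _)
      ... | no gb≢d  = g , record { involutive = Mg .involutive ; edge = old } , g-perfect
        where
        old : ∀ v → g v ≢ v → G .E v (g v)
        old v gv≢v with Mg .edge v gv≢v
        ... | inj₁ Evgv                    = Evgv
        ... | inj₂ (inj₁ (refl , gb≡d))    = contradiction gb≡d gb≢d
        ... | inj₂ (inj₂ (refl , gd≡b))    = contradiction (flip Mg gd≡b) gb≢d

-- The binding number

-- Replaces the real `ε` by a rational in its lower cut. That cut is open, which settles the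
-- boundary case `p - c = q`.
<-of-real : ∀ (ε : ℝ) {q} c b → ℝ.lower ε q → (c ℚ+ℝ ε) <ᵣ fromℚ b → c ℚ.+ q ℚ.< b
<-of-real ε {q} c b q<ε (p , ε<p-c , p<b) = ℚₚ.<-trans
  (subst (c ℚ.+ q ℚ.<_) cancel (ℚₚ.+-monoʳ-< c q<p-c)) p<b
  where
  q<p-c : q ℚ.< p ℚ.- c
  q<p-c = ℚₚ.≰⇒> λ p-c≤q → ℝ.disjoint ε (down (ℚₚ.≤-<-trans p-c≤q (proj₁ (proj₂ q+)))) ε<p-c
    where
    q+ = ℝ.lower-open ε q<ε
    down : p ℚ.- c ℚ.< proj₁ q+ → ℝ.lower ε (p ℚ.- c)
    down lt = ℝ.lower-closed ε lt (proj₂ (proj₂ q+))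
  cancel : c ℚ.+ (p ℚ.- c) ≡ p
  cancel = trans (cong (c ℚ.+_) (ℚₚ.+-comm p (ℚ.- c)))
    (trans (sym (ℚₚ.+-assoc c (ℚ.- c) p))
      (trans (cong (ℚ._+ p) (ℚₚ.+-inverseʳ c)) (ℚₚ.+-identityˡ p)))

-- Over the denominator `3 * m` the left side has numerator `4 * m + 3 * (k + 1)`, which is at least
-- `4 * m + 1`.
clear-denominators : ∀ k m-1 .(cop : Coprime (suc k) (suc m-1)) a s .{{_ : NonZero s}} →
  (+ 4 / 3) ℚ.+ mkℚ +[1+ k ] m-1 cop ℚ.< + a / s →
  (1 + 4 * suc m-1) * s ≤ 3 * suc m-1 * a
clear-denominators k m-1 cop a (suc s-1) lt = begin
  (1 + 4 * m) * s                    ≤⟨ *-monoˡ-≤ s (+-monoˡ-≤ (4 * m) (m≤m+n 1 (k * 3 + 2))) ⟩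
  (1 + (k * 3 + 2) + 4 * m) * s      ≡⟨ regroup k m s ⟩
  (4 * m + suc k * 3) * s            ≤⟨ <⇒≤ (ℤₚ.drop‿+<+ integral) ⟩
  a * (3 * m)                        ≡⟨ *-comm a (3 * m) ⟩
  3 * m * a                          ∎
  where
  open ≤-Reasoning
  regroup : ∀ k m s → (1 + (k * 3 + 2) + 4 * m) * s ≡ (4 * m + (1 + k) * 3) * s
  regroup k m s = solve (k ∷ m ∷ s ∷ [])
  m = suc m-1
  s = suc s-1
  -- Unnormalised fractions keep their denominators, so cross multiplication involves no common
  -- divisors.
  unnormalised : mkℚᵘ (+ 4) 2 ℚᵘ.+ mkℚᵘ +[1+ k ] m-1 ℚᵘ.< mkℚᵘ (+ a) s-1
  unnormalised = ℚᵘₚ.<-respʳ-≃ (ℚₚ.toℚᵘ-fromℚᵘ (mkℚᵘ (+ a) s-1))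
    (ℚᵘₚ.<-respˡ-≃ (ℚₚ.toℚᵘ-homo-+ (+ 4 / 3) (mkℚ +[1+ k ] m-1 cop)) (ℚₚ.toℚᵘ-mono-< lt))
  integral : + ((4 * m + suc k * 3) * s) ℤ.< + (a * (3 * m))
  integral = subst₂ ℤ._<_
    (trans (cong (ℤ._* + s) (cong₂ ℤ._+_ (sym (ℤₚ.pos-* 4 m)) (sym (ℤₚ.pos-* (suc k) 3))))
           (sym (ℤₚ.pos-* (4 * m + suc k * 3) s)))
    (sym (ℤₚ.pos-* a (3 * m)))
    (ℚᵘₚ.drop-*<* unnormalised)

-- `m` is the denominator of a positive rational below `ε`; every ratio `a / s` that is at least `b`
-- then exceeds 4/3 + 1/(3m).
slope : ∀ (ε : ℝ) → fromℚ 0ℚ <ᵣ ε → ∃[ m ] ∀ b → ((+ 4 / 3) ℚ+ℝ ε) <ᵣ fromℚ b →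
        ∀ a s .{{_ : NonZero s}} → b ℚ.≤ + a / s → (1 + 4 * m) * s ≤ 3 * m * a
slope ε (q , 0<q , q<ε) with q | ℚ.positive 0<q | q<ε
... | mkℚ +[1+ k ] m-1 cop | _ | q<ε′ = suc m-1 , λ b b> a s b≤ →
  clear-denominators k m-1 cop a s (ℚₚ.<-≤-trans (<-of-real ε (+ 4 / 3) b q<ε′ b>) b≤)

-- Decidable predicates as subsets, and the binding condition for induced subgraphs

module _ {n : ℕ} {P : Pred (Fin n) 0ℓ} (P? : Decidable P) where

  subset : Subset n
  subset = tabulate (does ∘ P?)

  ∈-subset⁺ : ∀ {v} → P v → v ∈ subset
  ∈-subset⁺ {v} p = lookup⇒[]= v subset (trans (lookup∘tabulate (does ∘ P?) v) (dec-true (P? v) p))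

  ∈-subset⁻ : ∀ {v} → v ∈ subset → P v
  ∈-subset⁻ {v} v∈ with P? v | trans (sym (lookup∘tabulate (does ∘ P?) v)) ([]=⇒lookup v∈)
  ... | yes p | _  = p
  ... | no _  | ()

∣subset∣ : ∀ {n} {P : Pred (Fin n) 0ℓ} (P? : Decidable P) → ∣ subset P? ∣ ≡ count P?
∣subset∣ {zero}  P? = refl
∣subset∣ {suc n} P? with P? zero
... | yes _ = cong suc (∣subset∣ (P? ∘ suc))
... | no  _ = ∣subset∣ (P? ∘ suc)

∣∣≡count : ∀ {n} (S : Subset n) → ∣ S ∣ ≡ count (_∈? S)
∣∣≡count Vec.[] = refl
∣∣≡count {suc n} (s Vec.∷ S) = head s
  where
  rest : ∀ s → ∣ S ∣ ≡ count {n} (λ v → suc v ∈? (s Vec.∷ S))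
  rest s = trans (∣∣≡count S) (count-cong {n} (_∈? S) (λ v → suc v ∈? (s Vec.∷ S))
    (λ _ → Vec.there) λ { _ (Vec.there v∈S) → v∈S })
  head : ∀ s → ∣ s Vec.∷ S ∣ ≡ count (_∈? (s Vec.∷ S))
  head true  = cong suc (rest true)
  head false = rest false

module _ (G : Graph) where

  open Graph G using (Vertex; Adj; adj?; symm; irrefl)

  private
    p = order G

  induced : (W : Pred Vertex 0ℓ) → Decidable W → GraphOn W
  induced W W? = record
    { E     = λ u v → Adj u v × W u × W v
    ; E?    = λ u v → adj? u v ×-dec (W? u ×-dec W? v)
    ; E-sym = λ { (a , wu , wv) → symm a , wv , wu }
    ; E-irr = irrefl ∘ proj₁
    ; E-in  = proj₁ ∘ proj₂
    }

  -- Neighbours are taken in all of `G`. Since X and Y lie in `W`, no vertex of Y is a neighbour of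
  -- X; as Y is nonempty, X is admissible in the minimum.
  binding : ∀ {m b} → IsBindingNumber G b →
    (∀ a s .{{_ : NonZero s}} → b ℚ.≤ + a / s → (1 + 4 * m) * s ≤ 3 * m * a) →
    ∀ {W : Pred Vertex 0ℓ} (W? : Decidable W) → Binding W m (GraphOn.E (induced W W?))
  binding {m} {b} (_ , minimal) slope {W} W? {X} {Y} X? Y? (x , Xx) (y , Yy) X⊆W Y⊆W apart = begin
    (1 + 4 * m) * count X? + 3 * m * count Y?
      ≤⟨ +-monoˡ-≤ (3 * m * count Y?) bound ⟩
    3 * m * count N? + 3 * m * count Y?
      ≡⟨ *-distribˡ-+ (3 * m) (count N?) (count Y?) ⟨
    3 * m * (count N? + count Y?)
      ≤⟨ *-monoʳ-≤ (3 * m) (+-monoʳ-≤ (count N?) (count-mono-≤ Y? (¬? ∘ N?) λ v → Y-apart {v})) ⟩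
    3 * m * (count N? + count (¬? ∘ N?))
      ≡⟨ cong (3 * m *_) (count-complement N?) ⟩
    3 * m * p ∎
    where
    open ≤-Reasoning
    S = subset X?
    -- The same decision procedure as in `neighbours`, so `neighbours G S` is `subset N?` by
    -- definition.
    N? : Decidable (λ v → ∃ λ u → u ∈ S × Adj u v)
    N? v = any? λ u → (u ∈? S) ×-dec adj? u v
    Y-apart : ∀ {v} → Y v → ¬ ∃ λ u → u ∈ S × Adj u v
    Y-apart {v} Yv (u , u∈S , Auv) = apart u v Xu Yv (Auv , X⊆W u Xu , Y⊆W v Yv)
      where Xu = ∈-subset⁻ X? u∈S
    N≢⊤ : neighbours G S ≢ ⊤
    N≢⊤ eq = Y-apart Yy (∈-subset⁻ N? (subst (y ∈_) (sym eq) ∈⊤))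
    bound : (1 + 4 * m) * count X? ≤ 3 * m * count N?
    bound = subst₂ (λ s a → (1 + 4 * m) * s ≤ 3 * m * a) (∣subset∣ X?) (∣subset∣ N?)
      (slope ∣ neighbours G S ∣ ∣ S ∣ {{>-nonZero (subst (1 ≤_) (sym (∣subset∣ X?)) (1≤count X? Xx))}}
        (minimal S (x , ∈-subset⁺ X? Xx) N≢⊤))

  -- From involutions to lists of edges

  module _ {W : Pred Vertex 0ℓ} (W? : Decidable W) {h : Vertex → Vertex}
           (PM : PerfectMatching {W = W} (GraphOn.E (induced W W?)) h) where

    private
      M = proj₁ PM
      up? : Decidable (λ v → v Fin.< h v)
      up? v = v Finₚ.<? h v
      ups = filter up? (allFin p)

    edges : List (Vertex × Vertex)
    edges = map (λ v → v , h v) ups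

    edges-all : All (λ (u , v) → u Fin.< v × Adj u v × W u × W v) edges
    edges-all = Allₚ.map⁺ (All.map edge′ (Allₚ.all-filter up? (allFin p)))
      where
      edge′ : ∀ {v} → v Fin.< h v → v Fin.< h v × Adj v (h v) × W v × W (h v)
      edge′ {v} v<hv = v<hv , M .edge v (Finₚ.<⇒≢ v<hv ∘ sym)

    edges-disjoint : AllPairs (Disjoint G) edges
    edges-disjoint = AllPairsₚ.map⁺ (pairs (Allₚ.all-filter up? (allFin p))
                                           (Uniqueₚ.filter⁺ up? (Uniqueₚ.allFin⁺ p)))
      where
      apart : ∀ {u v} → u Fin.< h u → v Fin.< h v → u ≢ v → Disjoint G (u , h u) (v , h v)
      apart u<hu v<hv u≢v w (inj₁ refl) (inj₁ u≡v)   = u≢v u≡v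
      apart u<hu v<hv u≢v w (inj₁ refl) (inj₂ refl)  = Finₚ.<-asym v<hv (subst (w Fin.<_) (M .involutive _) u<hu)
      apart u<hu v<hv u≢v w (inj₂ refl) (inj₁ refl)  = Finₚ.<-asym u<hu (subst (w Fin.<_) (M .involutive _) v<hv)
      apart u<hu v<hv u≢v w (inj₂ refl) (inj₂ hu≡hv) = u≢v (injective M hu≡hv)

      pairs : ∀ {vs} → All (λ v → v Fin.< h v) vs → AllPairs _≢_ vs →
              AllPairs (λ u v → Disjoint G (u , h u) (v , h v)) vs
      pairs All.[]           AllPairs.[]           = AllPairs.[]
      pairs (up All.∷ ups) (ne AllPairs.∷ nes) = All.zipWith (λ (up′ , u≢v) → apart up up′ u≢v) (ups , ne)
        AllPairs.∷ pairs ups nes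

    edges-cover : ∀ w → W w → Any (λ e → _∈ₑ_ G w e) edges
    edges-cover w Ww with Finₚ.<-cmp w (h w)
    ... | tri< w<hw _ _ = lose
      (∈-map⁺ (λ v → v , h v) (∈-filter⁺ up? (∈-allFin w) w<hw)) (inj₁ refl)
    ... | tri≈ _ w≡hw _ = contradiction (sym w≡hw) (proj₂ PM w Ww)
    ... | tri> _ _ hw<w = lose
      (∈-map⁺ (λ v → v , h v) (∈-filter⁺ up? (∈-allFin (h w)) (subst (h w Fin.<_) (sym (M .involutive w)) hw<w)))
      (inj₂ (sym (M .involutive w)))

  -- Vertices left over by a given matching

  Covered : List (Vertex × Vertex) → Pred Vertex 0ℓ
  Covered M w = Any (λ e → _∈ₑ_ G w e) M

  covered? : ∀ M → Decidable (Covered M)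
  covered? M w = Any.any? (λ (u , v) → w ≟ u ⊎-dec w ≟ v) M

  count-covered : ∀ {W M} → IsMatching G W M → count (covered? M) ≡ 2 * length M
  count-covered {M = []} _ = count-none (covered? []) λ _ ()
  count-covered {M = (u , v) ∷ M} ((u<v , _) All.∷ edges , disjoint AllPairs.∷ rest) = trans
    (count-partition ends? (covered? M) (covered? ((u , v) ∷ M))
      (λ { _ (here w∈e) → inj₁ w∈e ; _ (there c) → inj₂ c }) (λ _ → here) (λ _ → there)
      (λ w w∈e → notCovered disjoint w∈e))
    (trans (cong₂ _+_ (count-pair (Finₚ.<⇒≢ u<v)) (count-covered (edges , rest)))
           (sym (*-suc 2 (length M))))
    where
    ends? : Decidable (λ w → _∈ₑ_ G w (u , v))
    ends? w = w ≟ u ⊎-dec w ≟ v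
    notCovered : ∀ {M w} → All (Disjoint G (u , v)) M → _∈ₑ_ G w (u , v) → ¬ Covered M w
    notCovered {w = w} (d All.∷ _) w∈e (here w∈f) = d w w∈e w∈f
    notCovered (_ All.∷ ds) w∈e (there c) = notCovered ds w∈e c

  covered-inside : ∀ {W M} → IsMatching G W M → ∀ w → Covered M w → w ∈ W
  covered-inside ((_ , _ , u∈W , _) All.∷ _ , _) w (here (inj₁ refl)) = u∈W
  covered-inside ((_ , _ , _ , v∈W) All.∷ _ , _) w (here (inj₂ refl)) = v∈W
  covered-inside (_ All.∷ edges , _ AllPairs.∷ rest)      w (there c)          = covered-inside (edges , rest) w c

  -- The equal remainders of `p` and `n` cancel, and `w` is left as a difference of even numbers.
  even-remainder : ∀ w n k → w + (n + 2 * k) ≡ p → p % 2 ≡ n % 2 → 2 ∣ w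
  even-remainder w n k eq parity = ∣m+n∣m⇒∣n
    (divides (p DivMod./ 2) (+-cancelˡ-≡ (n % 2) _ _ (begin
      n % 2 + ((n DivMod./ 2 + k) * 2 + w)
        ≡⟨ regroup (n % 2) (n DivMod./ 2) ⟩
      w + ((n % 2 + n DivMod./ 2 * 2) + 2 * k)
        ≡⟨ cong (λ z → w + (z + 2 * k)) (DivMod.m≡m%n+[m/n]*n n 2) ⟨
      w + (n + 2 * k)
        ≡⟨ eq ⟩
      p
        ≡⟨ DivMod.m≡m%n+[m/n]*n p 2 ⟩
      p % 2 + p DivMod./ 2 * 2
        ≡⟨ cong (_+ p DivMod./ 2 * 2) parity ⟩
      n % 2 + p DivMod./ 2 * 2 ∎)))
    (divides (n DivMod./ 2 + k) refl)
    where
    open ≡-Reasoning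
    regroup : ∀ r d → r + ((d + k) * 2 + w) ≡ w + ((r + d * 2) + 2 * k)
    regroup r d = solve (r ∷ d ∷ k ∷ w ∷ [])

  ∁-count : ∀ (D : Subset p) → count (_∈? ∁ D) + ∣ D ∣ ≡ p
  ∁-count D = trans (+-comm (count (_∈? ∁ D)) ∣ D ∣) (trans
    (cong₂ _+_ (∣∣≡count D) (count-cong (_∈? ∁ D) (¬? ∘ (_∈? D)) (λ _ → x∈∁p⇒x∉p) (λ _ → x∉p⇒x∈∁p)))
    (count-complement (_∈? D)))

  Uncovered : Subset p → List (Vertex × Vertex) → Pred Vertex 0ℓ
  Uncovered D M v = v ∈ ∁ D × ¬ Covered M v

  uncovered? : ∀ D M → Decidable (Uncovered D M)
  uncovered? D M v = v ∈? ∁ D ×-dec ¬? (covered? M v)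

  uncovered-split : ∀ D M v → v ∈ ∁ D → Uncovered D M v ⊎ Covered M v
  uncovered-split D M v v∈ with covered? M v
  ... | yes c = inj₂ c
  ... | no ¬c = inj₁ (v∈ , ¬c)

  uncovered-count : ∀ D {M} → IsMatching G (∁ D) M →
                    count (uncovered? D M) + (∣ D ∣ + 2 * length M) ≡ p
  uncovered-count D {M} matching = begin
    count (uncovered? D M) + (∣ D ∣ + 2 * length M)
      ≡⟨ cong (λ z → count (uncovered? D M) + z) (+-comm ∣ D ∣ (2 * length M)) ⟩
    count (uncovered? D M) + (2 * length M + ∣ D ∣)
      ≡⟨ +-assoc (count (uncovered? D M)) (2 * length M) ∣ D ∣ ⟨
    count (uncovered? D M) + 2 * length M + ∣ D ∣
      ≡⟨ cong (λ c → count (uncovered? D M) + c + ∣ D ∣) (count-covered matching) ⟨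
    count (uncovered? D M) + count (covered? M) + ∣ D ∣
      ≡⟨ cong (_+ ∣ D ∣) (count-partition (uncovered? D M) (covered? M) (_∈? ∁ D) (uncovered-split D M)
           (λ _ → proj₁) (covered-inside matching) (λ _ → proj₂)) ⟨
    count (_∈? ∁ D) + ∣ D ∣
      ≡⟨ ∁-count D ⟩
    p ∎
    where open ≡-Reasoning

  -- The new edges have uncovered ends, so they can be appended to `M` without meeting it.
  extend-by : ∀ D M → IsMatching G (∁ D) M → ∀ h →
    PerfectMatching {W = Uncovered D M} (GraphOn.E (induced (Uncovered D M) (uncovered? D M))) h →
    ∃[ M′ ] (IsPerfectMatching G (∁ D) M′ × M ⊆ M′)
  extend-by D M (edgesM , disjointM) h PM =
    M ++ L , ((Allₚ.++⁺ edgesM (All.map inside (edges-all (uncovered? D M) PM)) ,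
               AllPairsₚ.++⁺ disjointM (edges-disjoint (uncovered? D M) PM)
                 (All.tabulate λ e∈M → All.map (across e∈M) (edges-all (uncovered? D M) PM)))
             , cover) , xs⊆xs++ys M L
    where
    L = edges (uncovered? D M) PM

    NewEdge : Pred (Vertex × Vertex) 0ℓ
    NewEdge (u , v) = u Fin.< v × Adj u v × Uncovered D M u × Uncovered D M v

    inside : ∀ {e} → NewEdge e → IsEdge G (∁ D) e
    inside (lt , a , Wu , Wv) = lt , a , proj₁ Wu , proj₁ Wv

    across : ∀ {e f} → Any (e ≡_) M → NewEdge f → Disjoint G e f
    across e∈M (_ , _ , Wu , Wv) w w∈e (inj₁ refl) = proj₂ Wu (lose e∈M w∈e)
    across e∈M (_ , _ , Wu , Wv) w w∈e (inj₂ refl) = proj₂ Wv (lose e∈M w∈e)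

    cover : ∀ w → w ∈ ∁ D → Any (λ e → _∈ₑ_ G w e) (M ++ L)
    cover w w∈ with uncovered-split D M w w∈
    ... | inj₁ Ww = Anyₚ.++⁺ʳ M (edges-cover (uncovered? D M) PM w Ww)
    ... | inj₂ c  = Anyₚ.++⁺ˡ c

  -- Extendability of graphs of large order

  module _ {m n : ℕ} {b : ℚ} (isBinding : IsBindingNumber G b)
    (bounded : ∀ a s .{{_ : NonZero s}} → b ℚ.≤ + a / s → (1 + 4 * m) * s ≤ 3 * m * a)
    (parity : p % 2 ≡ n % 2) where

    -- The ends of `M` are deleted along with `D`, in all `n + 2 * length M` vertices.
    extend-matching : ∀ (D : Subset p) → ∣ D ∣ ≡ n → ∀ M → IsMatching G (∁ D) M →
      Arithmetic.vertexBound m (n + 2 * length M) < p →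
      ∃[ M′ ] (IsPerfectMatching G (∁ D) M′ × M ⊆ M′)
    extend-matching D refl M matching large
      with h , PM ← Existence.perfect (uncovered? D M) m (n + 2 * length M) (uncovered-count D matching)
             (even-remainder (count (uncovered? D M)) n (length M) (uncovered-count D matching) parity)
             large (induced (Uncovered D M) (uncovered? D M)) (binding {m} isBinding bounded (uncovered? D M)) (<-wellFounded _)
      = extend-by D M matching h PM

    -- Extending the empty matching gives a perfect one. It covers the at least `2 * k` vertices
    -- outside `D`, so it has `k` edges to take.
    find-matching : ∀ k → n + 2 * k ≤ p → ∀ (D : Subset p) → ∣ D ∣ ≡ n →
      Arithmetic.vertexBound m (n + 0) < p →
      ∃[ M ] (IsMatching G (∁ D) M × length M ≡ k)
    find-matching k enough D ∣D∣≡n large with extend-matching D ∣D∣≡n [] (All.[] , AllPairs.[]) large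
    ... | M , ((edgesM , disjointM) , cover) , _ =
      take k M , (Allₚ.take⁺ k edgesM , AllPairsₚ.take⁺ k disjointM) ,
      trans (length-take k M) (m≤n⇒m⊓n≡m (*-cancelˡ-≤ 2 k≤M))
      where
      k≤M : 2 * k ≤ 2 * length M
      k≤M = +-cancelʳ-≤ n _ _ (begin
        2 * k + n                     ≡⟨ +-comm (2 * k) n ⟩
        n + 2 * k                     ≤⟨ enough ⟩
        p                             ≡⟨ ∁-count D ⟨
        count (_∈? ∁ D) + ∣ D ∣       ≤⟨ +-mono-≤ (count-mono-≤ (_∈? ∁ D) (covered? M) cover) (≤-reflexive ∣D∣≡n) ⟩
        count (covered? M) + n        ≡⟨ cong (_+ n) (count-covered (edgesM , disjointM)) ⟩
        2 * length M + n              ∎)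
        where open ≤-Reasoning

corollary2p3 : (n k : ℕ) → 0 < n → 0 < k →
    (ε : ℝ) → fromℚ 0ℚ <ᵣ ε → ε <ᵣ fromℚ (+ 1 / 3) →
    ∃[ N ] ((G : Graph) → Connected G → order G % 2 ≡ n % 2 →
    (b : ℚ) → IsBindingNumber G b →
    ((+ 4 / 3) ℚ+ℝ ε) <ᵣ fromℚ b →
    N ≤ order G →
    Extendable G n k)
corollary2p3 n k _ _ ε 0<ε _ with slope ε 0<ε
-- The summand `s` gives the required order and, being positive, strictness; `vb k` serves the
-- extension of a `k`-matching and `vb 0` that of the empty one.
... | m , above = s + (vb k + vb 0) , λ G _ parity b isBinding b> N≤ → record
  { large  = ≤-trans (m≤m+n s _) N≤
  ; parity = parity
  ; exists = λ D ∣D∣≡n → find-matching G {m} isBinding (above b b>) parity k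
      (≤-trans (m≤m+n (n + 2 * k) 2) (≤-trans (m≤m+n s _) N≤)) D ∣D∣≡n
      (≤-trans (+-mono-≤ 1≤s (m≤n+m (vb 0) (vb k))) N≤)
  ; extend = λ { D ∣D∣≡n M matching refl →
      extend-matching G {m} isBinding (above b b>) parity D ∣D∣≡n M matching
        (≤-trans (+-mono-≤ 1≤s (m≤m+n (vb k) (vb 0))) N≤) }
  }
  where
  s = n + 2 * k + 2
  vb : ℕ → ℕ
  vb j = Arithmetic.vertexBound m (n + 2 * j)
  1≤s : 1 ≤ s
  1≤s = ≤-trans (s≤s z≤n) (m≤n+m 2 (n + 2 * k))
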